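{- Let $p>3$ be a prime and let $d\in\mathbb{Z}$. Write $n=(p-1)/2$ and define $$S(d,p)=\det\left[\left(\frac{j^2+dk^2}{p}\right)\right]_{1\le j,k\le n},\qquad T(d,p)=\det\left[\left(\frac{j^2+dk^2}{p}\right)\right]_{0\le j,k\le n}.$$ (i) Let $\bar S(d,p)$ be the determinant obtained from $\det\left[\left(\frac{j^2+dk^2}{p}\right)\right]_{1\le j,k\le n}$ by replacing all the entries in the first row (the row $j=1$) by $1$. If $\left(\frac dp\right)=1$, then $\bar S(d,p)=-S(d,p)$. If $\left(\frac dp\right)=-1$, then $$\bar S(d,p)=\frac{2}{p-1}T(d,p)=\frac{p-1}{2}\det\left[\left(\frac{j^2+dk^2}{p}\right)\right]_{2\le j,k\le n}.$$ (ii) For any integer $m$ with $(p-1)/2<m<p-1$, the determinant $T_m(d,p)=\det\left[(j^2+dk^2)^m\right]_{0\le j,k\le (p-1)/2}$ satisfies $T_m(d,p)\equiv 0\pmod p$.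
   Context: $\left(\frac{\cdot}{p}\right)$ denotes the Legendre symbol modulo $p$ (with $\left(\frac{0}{p}\right)=0$). -}

module Defs where

open import Data.Bool.Base using (if_then_else_)
open import Data.Fin.Base using (Fin; zero; suc; toℕ; punchIn)
open import Data.Fin.Properties using (any?)
open import Data.Integer.Base using (ℤ; +_; _+_; _-_; _*_; _^_; 0ℤ; 1ℤ; -1ℤ)
open import Data.Integer.Divisibility.Signed using (_∣_; _∣?_)
open import Data.Integer.Properties using (+-*-semiring)
open import Algebra.Properties.Semiring.Sum +-*-semiring using (sum)
open import Data.Nat.Base as ℕ using (ℕ; NonZero; _∸_; _>_; s≤s; _≡ᵇ_)
open import Data.Product.Base using (∃)
open import Data.Rational.Base as ℚ using (ℚ)
open import Relation.Nullary.Decidable using (Dec; does)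

-- x ranges over the complete residue system 0, …, p - 1.
IsSquareMod : ℕ → ℤ → Set
IsSquareMod p a = ∃ λ (x : Fin p) → + p ∣ (+ toℕ x) ^ 2 - a

isSquareMod? : ∀ p a → Dec (IsSquareMod p a)
isSquareMod? p a = any? λ x → + p ∣? (+ toℕ x) ^ 2 - a

-- Meaningful for p an odd prime.
legendre : ℤ → ℕ → ℤ
legendre a p =
  if does (+ p ∣? a) then 0ℤ
  else if does (isSquareMod? p a) then 1ℤ
  else -1ℤ

-- Cofactor expansion along the first row; the empty determinant is 1.
det : ∀ {n} → (Fin n → Fin n → ℤ) → ℤ
det {ℕ.zero}  A = 1ℤ
det {ℕ.suc n} A = sum λ j →
  -1ℤ ^ toℕ j * (A zero j * det (λ i k → A (suc i) (punchIn j k)))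

-- det [ f j k ] over lo ≤ j, k ≤ hi, for lo ≤ hi + 1; the row index is j.
detRange : (lo hi : ℕ) → (ℕ → ℕ → ℤ) → ℤ
detRange lo hi f =
  det {ℕ.suc hi ∸ lo} λ j k → f (lo ℕ.+ toℕ j) (lo ℕ.+ toℕ k)

form : ℤ → ℕ → ℕ → ℤ
form d j k = (+ j) ^ 2 + d * (+ k) ^ 2

half : ℕ → ℕ
half p = (p ∸ 1) ℕ./ 2

entry : ℤ → ℕ → ℕ → ℕ → ℤ
entry d p j k = legendre (form d j k) p

S : ℤ → ℕ → ℤ
S d p = detRange 1 (half p) (entry d p)

T : ℤ → ℕ → ℤ
T d p = detRange 0 (half p) (entry d p)

S̄ : ℤ → ℕ → ℤ
S̄ d p = detRange 1 (half p) λ j k → if j ≡ᵇ 1 then 1ℤ else entry d p j k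

Tₘ : ℕ → ℤ → ℕ → ℤ
Tₘ m d p = detRange 0 (half p) λ j k → form d j k ^ m

fromℤ : ℤ → ℚ
fromℤ i = i ℚ./ 1

p>3⇒p∸1≢0 : ∀ {p} → p > 3 → NonZero (p ∸ 1)
p>3⇒p∸1≢0 (s≤s (s≤s _)) = _

module Submission where

-- Write χ for the Legendre symbol modulo p. Power sums over a complete residue
-- system vanish modulo p for exponents 0 < e < p - 1, so by the binomial theorem
-- Σ_{1≤j≤n} (u j² + w)ᵐ ≡ n (wᵐ + C(m,n) uⁿ wᵐ⁻ⁿ) for n ≤ m < p - 1.
-- For m = p - 1 the analogous formula yields Euler's criterion; for m = n it gives
-- the row and column sums of the matrix [χ(j² + dk²)] modulo p, and these sums are
-- too small for the congruences not to be equalities: they are all -1 if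
-- χ(d) = 1, and all 0 if χ(d) = -1. The identities of (i) then follow by replacing
-- one row (or column) by the sum of all of them.
-- For n < m < p - 1 the formula exhibits a linear relation modulo p between the
-- rows of Tₘ.

open import Defs
open import Algebra.Properties.AbelianGroup using (∙-cancelˡ)
import Algebra.Properties.CommutativeSemiring.Binomial as BinomialTheorem
open import Data.Bool.Base using (if_then_else_)
open import Data.Fin.Base using (Fin; zero; suc; toℕ; fromℕ<; punchIn; pinch)
open import Data.Fin.Properties using (toℕ<n; toℕ-fromℕ<; punchInᵢ≢i) renaming (_≟_ to _≟ᶠ_)
open import Data.Integer.Divisibility.Signed
open import Data.Integer.DivMod using (_%ℕ_; _/ℕ_; a≡a%ℕn+[a/ℕn]*n)
open import Data.Integer.Properties
open import Algebra.Properties.Semiring.Exp +-*-semiring using () renaming (_^_ to _^′_)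
open import Algebra.Properties.Semiring.Mult +-*-semiring using () renaming (_×_ to _·_)
open import Algebra.Properties.Semiring.Sum +-*-semiring
  using ( sum; sum-syntax; sum-cong-≗; sum-replicate-zero
        ; ∑-distrib-+; ∑-comm; *-distribˡ-sum; *-distribʳ-sum)
open import Data.Integer.Tactic.RingSolver using (solve-∀)
open import Data.Nat.Base as ℕ using (ℕ; zero; suc; z≤n; s≤s; z<s; s<s)
open import Data.Nat.Combinatorics
  using (_C_; nCk+nC[k+1]≡[n+1]C[k+1]; nCn≡1; nC1≡n; nCk≡nC[n∸k]; k>n⇒nCk≡0)
import Data.Nat.Divisibility as ℕ
open import Data.Nat.DivMod using (m*n/n≡m)
open import Data.Nat.Induction using (<-rec)
open import Data.Nat.Primality using (Prime; euclidsLemma; prime⇒irreducible)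
import Data.Nat.Properties as ℕ
open import Data.Nat.Tactic.RingSolver renaming (solve-∀ to solve-∀ℕ)
open import Data.Product.Base using (∃; _×_; _,_)
import Data.Rational.Base as ℚ
open import Data.Rational.Properties using (toℚᵘ-injective; toℚᵘ-homo-*; toℚᵘ-fromℚᵘ)
import Data.Rational.Unnormalised.Base as ℚᵘ
import Data.Rational.Unnormalised.Properties as ℚᵘ
open import Data.Sum.Base using (_⊎_; inj₁; inj₂)
open import Function.Base using (_∘_; flip)
open import Level using (0ℓ)
open import Relation.Binary.Bundles using (Setoid)
open import Relation.Binary.PropositionalEquality
import Relation.Binary.Reasoning.Setoid as SetoidReasoning
open import Relation.Nullary using (Dec; does; yes; no; ¬_; contradiction)

-- No primitive root is used: a power sum vanishes because (x + 1)^(e+1) - x^(e+1) telescopes and e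
-- + 1 < p can be cancelled. Folding x with p - x leaves sums of powers of the squares of 1, ..., n;
-- by Fermat these are periodic in the exponent with period n, so a binomial expansion keeps just
-- the terms whose index is a multiple of n. For n ≤ m < p - 1 these are k = 0 and k = n, while m =
-- p - 1 adds k = 2n. The non-residue half of Euler's criterion comes from this last case instead of
-- a count of the roots of a polynomial. The row and column sums are n (χ(d) + 1) modulo p, and 2n ≡
-- -1 turns this into -1 or 0; a sum of n symbols differs from such a value by at most 2n < p. On
-- the side of determinants the obstacle is that `det` knows only its first row: expansion along any
-- row, vanishing for equal rows and invariance under transposition have to be derived before a row
-- can be replaced by a combination of rows.

-- Determinants: Laplace expansion, row combinations, bordered matrices.

module Determinant where

  open import Data.Integer.Base hiding (suc)
  open ≡-Reasoning

  Matrix : ℕ → Set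
  Matrix n = Fin n → Fin n → ℤ

  sum-zero : ∀ {n} {f : Fin n → ℤ} → (∀ i → f i ≡ 0ℤ) → sum f ≡ 0ℤ
  sum-zero {n} f≡0 = trans (sum-cong-≗ f≡0) (sum-replicate-zero n)

  det-cong : ∀ {n} {A B : Matrix n} → (∀ i j → A i j ≡ B i j) → det A ≡ det B
  det-cong {zero}  A≗B = refl
  det-cong {suc n} A≗B = sum-cong-≗ λ j →
    cong₂ (λ x y → -1ℤ ^ toℕ j * (x * y)) (A≗B zero j) (det-cong λ i k → A≗B (suc i) (punchIn j k))

  minor : ∀ {n} → Matrix (suc n) → Fin (suc n) → Fin (suc n) → Matrix n
  minor A r c i k = A (punchIn r i) (punchIn c k)

  cofactor : ∀ {n} → Matrix (suc n) → Fin (suc n) → Fin (suc n) → ℤ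
  cofactor A r c = -1ℤ ^ (toℕ r ℕ.+ toℕ c) * det (minor A r c)

  -- (j , k) stands for the ordered pair of distinct indices (j , punchIn j k);
  -- the pair (punchIn j k , j) is then (punchIn j k , pinch k j).
  sum-swap : ∀ {n} (f : Fin (suc n) → Fin n → ℤ) →
    ∑[ j < suc n ] ∑[ k < n ] (f j k) ≡ ∑[ j < suc n ] ∑[ k < n ] (f (punchIn j k) (pinch k j))
  sum-swap {zero}  f = refl
  sum-swap {suc n} f = begin
    X + ∑[ j < suc n ] (f (suc j) zero + ∑[ k < n ] (f (suc j) (suc k)))
      ≡⟨ cong (_+_ X) (∑-distrib-+ (λ j → f (suc j) zero) λ j → ∑[ k < n ] (f (suc j) (suc k))) ⟩
    X + (Y + ∑[ j < suc n ] ∑[ k < n ] (f (suc j) (suc k)))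
      ≡⟨ cong (λ z → X + (Y + z)) (sum-swap λ j k → f (suc j) (suc k)) ⟩
    X + (Y + Z)
      ≡⟨ lemma X Y Z ⟩
    Y + (X + Z)
      ≡⟨ cong (_+_ Y) (∑-distrib-+ (f zero) λ j → ∑[ k < n ] (f (suc (punchIn j k)) (suc (pinch k j)))) ⟨
    Y + ∑[ j < suc n ] (f zero j + ∑[ k < n ] (f (suc (punchIn j k)) (suc (pinch k j)))) ∎
    where
    X = ∑[ k < suc n ] (f zero k)
    Y = ∑[ k < suc n ] (f (suc k) zero)
    Z = ∑[ j < suc n ] ∑[ k < n ] (f (suc (punchIn j k)) (suc (pinch k j)))
    lemma : ∀ x y z → x + (y + z) ≡ y + (x + z)
    lemma = solve-∀

  -- Both sides enumerate the indices other than `j` and `punchIn j k`; the order in which these two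
  -- are deleted is irrelevant, so double minors agree after the exchange.
  punchIn-swap : ∀ {n} (j : Fin (suc (suc n))) k b →
    punchIn j (punchIn k b) ≡ punchIn (punchIn j k) (punchIn (pinch k j) b)
  punchIn-swap zero    k       b       = refl
  punchIn-swap (suc j) zero    b       = refl
  punchIn-swap (suc j) (suc k) zero    = refl
  punchIn-swap (suc j) (suc k) (suc b) = cong suc (punchIn-swap j k b)

  punchIn-pinch : ∀ {n} (j : Fin (suc n)) k → punchIn (punchIn j k) (pinch k j) ≡ j
  punchIn-pinch {suc n} zero k = refl
  punchIn-pinch (suc j) zero    = refl
  punchIn-pinch (suc j) (suc k) = cong suc (punchIn-pinch j k)

  -- Reversing the order of two deletions changes the sum of the two positions by exactly one,
  -- because only the larger index is shifted when it is deleted second.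
  sign-swap : ∀ {n} (j : Fin (suc n)) k →
    -1ℤ ^ toℕ (punchIn j k) * -1ℤ ^ toℕ (pinch k j) ≡ - (-1ℤ ^ toℕ j * -1ℤ ^ toℕ k)
  sign-swap {suc n} zero k = lemma (-1ℤ ^ toℕ k)
    where
    lemma : ∀ x → -1ℤ * x * 1ℤ ≡ - (1ℤ * x)
    lemma = solve-∀
  sign-swap (suc j) zero = lemma (-1ℤ ^ toℕ j)
    where
    lemma : ∀ x → 1ℤ * x ≡ - (-1ℤ * x * 1ℤ)
    lemma = solve-∀
  sign-swap (suc j) (suc k) = begin
    -1ℤ * x * (-1ℤ * y) ≡⟨ lemma x y ⟩
    x * y               ≡⟨ sign-swap j k ⟩
    - (z * w)           ≡⟨ cong -_ (lemma z w) ⟨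
    - (-1ℤ * z * (-1ℤ * w)) ∎
    where
    x = -1ℤ ^ toℕ (punchIn j k)
    y = -1ℤ ^ toℕ (pinch k j)
    z = -1ℤ ^ toℕ j
    w = -1ℤ ^ toℕ k
    lemma : ∀ x y → -1ℤ * x * (-1ℤ * y) ≡ x * y
    lemma = solve-∀

  -- Induction on the row: expand along row 0, expand each minor along the wanted row, exchange the
  -- two chosen columns, and fold the row-0 expansion back. The sign of the exchange accounts for
  -- the step from `r` to `suc r`.
  laplace : ∀ {n} (A : Matrix (suc n)) r → det A ≡ ∑[ c < suc n ] (A r c * cofactor A r c)
  laplace A zero = sum-cong-≗ λ c → lemma (-1ℤ ^ toℕ c) (A zero c) (det (minor A zero c))
    where
    lemma : ∀ x y z → x * (y * z) ≡ y * (x * z)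
    lemma = solve-∀
  laplace {suc n} A (suc r) = begin
    ∑[ j < suc (suc n) ] (s j * (A zero j * det (minor A zero j)))
      ≡⟨ sum-cong-≗ (λ j → cong (λ z → s j * (A zero j * z)) (laplace (minor A zero j) r)) ⟩
    ∑[ j < suc (suc n) ] (s j * (A zero j * ∑[ k < suc n ] (g j k)))
      ≡⟨ sum-cong-≗ (λ j → trans (sym (*-assoc (s j) (A zero j) _)) (*-distribˡ-sum (s j * A zero j) (g j))) ⟩
    ∑[ j < suc (suc n) ] ∑[ k < suc n ] (f j k)
      ≡⟨ sum-swap f ⟩
    ∑[ j < suc (suc n) ] ∑[ k < suc n ] (f (punchIn j k) (pinch k j))
      ≡⟨ sum-cong-≗ (λ j → sum-cong-≗ (λ k → step j k)) ⟩
    ∑[ j < suc (suc n) ] ∑[ k < suc n ] (e j * h j k)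
      ≡⟨ sum-cong-≗ (λ j → trans (sym (*-distribˡ-sum (e j) (h j))) (*-assoc (A (suc r) j) _ _)) ⟩
    ∑[ j < suc (suc n) ] (A (suc r) j * cofactor A (suc r) j) ∎
    where
    s : ∀ {m} → Fin m → ℤ
    s j = -1ℤ ^ toℕ j
    D : Fin (suc (suc n)) → Fin (suc n) → ℤ
    D j k = det (minor (minor A (suc r) j) zero k)
    e : Fin (suc (suc n)) → ℤ
    e j = A (suc r) j * -1ℤ ^ (toℕ (suc r) ℕ.+ toℕ j)
    f g h : Fin (suc (suc n)) → Fin (suc n) → ℤ
    g j k = A (suc r) (punchIn j k) * cofactor (minor A zero j) r k
    f j k = s j * A zero j * g j k
    h j k = s k * (A zero (punchIn j k) * D j k)
    lemma₁ : ∀ sj′ a b t sk′ d → sj′ * a * (b * (t * sk′ * d)) ≡ (sj′ * sk′) * (a * (b * (t * d)))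
    lemma₁ = solve-∀
    lemma₂ : ∀ sj a b t sk d → - (sj * sk) * (a * (b * (t * d))) ≡ (b * (-1ℤ * (t * sj))) * (sk * (a * d))
    lemma₂ = solve-∀
    step : ∀ j k → f (punchIn j k) (pinch k j) ≡ e j * h j k
    step j k = begin
      f j′ k′
        ≡⟨ cong₂ (λ b e → s j′ * a * (A (suc r) b * (e * det (minor (minor A zero j′) r k′))))
             (punchIn-pinch j k) (^-distribˡ-+-* -1ℤ (toℕ r) (toℕ k′)) ⟩
      s j′ * a * (b * (s r * s k′ * det (minor (minor A zero j′) r k′)))
        ≡⟨ cong (λ d → s j′ * a * (b * (s r * s k′ * d)))
             (det-cong λ x y → cong (A (suc (punchIn r x))) (sym (punchIn-swap j k y))) ⟩
      s j′ * a * (b * (s r * s k′ * D j k))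
        ≡⟨ lemma₁ (s j′) a b (s r) (s k′) (D j k) ⟩
      s j′ * s k′ * (a * (b * (s r * D j k)))
        ≡⟨ cong (_* (a * (b * (s r * D j k)))) (sign-swap j k) ⟩
      - (s j * s k) * (a * (b * (s r * D j k)))
        ≡⟨ lemma₂ (s j) a b (s r) (s k) (D j k) ⟩
      (b * (-1ℤ * (s r * s j))) * (s k * (a * D j k))
        ≡⟨ cong (λ e → (b * (-1ℤ * e)) * (s k * (a * D j k))) (^-distribˡ-+-* -1ℤ (toℕ r) (toℕ j)) ⟨
      (b * -1ℤ ^ (toℕ (suc r) ℕ.+ toℕ j)) * (s k * (a * D j k)) ∎
      where
      j′ = punchIn j k
      k′ = pinch k j
      a = A zero j′
      b = A (suc r) j

  det-minors≡0 : ∀ {n} (A : Matrix (suc n)) r → (∀ c → det (minor A r c) ≡ 0ℤ) → det A ≡ 0ℤ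
  det-minors≡0 A r M≡0 = trans (laplace A r) (sum-zero {f = λ c → A r c * cofactor A r c} λ c →
    trans (cong (λ z → A r c * (-1ℤ ^ (toℕ r ℕ.+ toℕ c) * z)) (M≡0 c))
          (trans (cong (A r c *_) (*-zeroʳ (-1ℤ ^ (toℕ r ℕ.+ toℕ c)))) (*-zeroʳ (A r c))))

  -- Expanding along a third row keeps both equal rows in every minor.
  det-equalRows₀ : ∀ {n} (A : Matrix (suc n)) s → (∀ k → A zero k ≡ A (suc s) k) → det A ≡ 0ℤ
  det-equalRows₀ {suc zero} A zero eq = begin
    det A             ≡⟨ cong₂ det₂ (eq zero) (eq (suc zero)) ⟩
    det₂ a₁₀ a₁₁      ≡⟨ lemma a₁₀ a₁₁ ⟩
    0ℤ                ∎
    where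
    a₁₀ = A (suc zero) zero
    a₁₁ = A (suc zero) (suc zero)
    det₂ : ℤ → ℤ → ℤ
    det₂ x y = 1ℤ * (x * (1ℤ * (a₁₁ * 1ℤ) + 0ℤ)) + (-1ℤ * 1ℤ * (y * (1ℤ * (a₁₀ * 1ℤ) + 0ℤ)) + 0ℤ)
    lemma : ∀ x y → 1ℤ * (x * (1ℤ * (y * 1ℤ) + 0ℤ)) + (-1ℤ * 1ℤ * (y * (1ℤ * (x * 1ℤ) + 0ℤ)) + 0ℤ) ≡ 0ℤ
    lemma = solve-∀
  det-equalRows₀ {suc (suc n)} A zero    eq = det-minors≡0 A (suc (suc zero)) λ c →
    det-equalRows₀ (minor A (suc (suc zero)) c) zero (eq ∘ punchIn c)
  det-equalRows₀ {suc (suc n)} A (suc s) eq = det-minors≡0 A (suc zero) λ c →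
    det-equalRows₀ (minor A (suc zero) c) s (eq ∘ punchIn c)

  det-equalRows : ∀ {n} (A : Matrix n) {r s} → r ≢ s → (∀ k → A r k ≡ A s k) → det A ≡ 0ℤ
  det-equalRows A {zero}  {zero}  r≢s eq = contradiction refl r≢s
  det-equalRows A {zero}  {suc s} r≢s eq = det-equalRows₀ A s eq
  det-equalRows A {suc r} {zero}  r≢s eq = det-equalRows₀ A r (sym ∘ eq)
  det-equalRows {suc n} A {suc r} {suc s} r≢s eq = det-minors≡0 A zero λ c →
    det-equalRows (minor A zero c) (r≢s ∘ cong suc) (eq ∘ punchIn c)

  -- Replace row r by row s: the determinant has two equal rows.
  cofactor-orthogonal : ∀ {n} (A : Matrix (suc n)) {r s} → r ≢ s → ∑[ k < suc n ] (A s k * cofactor A r k) ≡ 0ℤ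
  cofactor-orthogonal {n} A {r} {s} r≢s = begin
    ∑[ k < suc n ] (A s k * cofactor A r k)
      ≡⟨ sum-cong-≗ (λ k → cong₂ (λ x y → x * (-1ℤ ^ (toℕ r ℕ.+ toℕ k) * y))
           (sym (B-r k)) (det-cong λ i j → sym (B-other (punchInᵢ≢i r i) (punchIn k j)))) ⟩
    ∑[ k < suc n ] (B r k * cofactor B r k)
      ≡⟨ laplace B r ⟨
    det B
      ≡⟨ det-equalRows B r≢s (λ k → trans (B-r k) (sym (B-other (r≢s ∘ sym) k))) ⟩
    0ℤ ∎
    where
    B : Matrix (suc n)
    B i k with i ≟ᶠ r
    ... | yes _ = A s k
    ... | no  _ = A i k
    B-r : ∀ k → B r k ≡ A s k
    B-r k with r ≟ᶠ r
    ... | yes _   = refl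
    ... | no  r≢r = contradiction refl r≢r
    B-other : ∀ {i} → i ≢ r → ∀ k → B i k ≡ A i k
    B-other {i} i≢r k with i ≟ᶠ r
    ... | yes i≡r = contradiction i≡r i≢r
    ... | no  _   = refl

  sum-head : ∀ {n} (f : Fin (suc n) → ℤ) → (∀ i → f (suc i) ≡ 0ℤ) → sum f ≡ f zero
  sum-head f f≡0 = trans (cong (_+_ (f zero)) (sum-zero {f = f ∘ suc} f≡0)) (+-identityʳ (f zero))

  sum-one : ∀ n → sum {n} (λ _ → 1ℤ) ≡ + n
  sum-one zero    = refl
  sum-one (suc n) = cong (_+_ 1ℤ) (sum-one n)

  sum-single : ∀ {n} (f : Fin n → ℤ) r → (∀ {i} → r ≢ i → f i ≡ 0ℤ) → sum f ≡ f r
  sum-single f zero    f≡0 = sum-head f λ i → f≡0 λ ()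
  sum-single f (suc r) f≡0 = trans
    (cong₂ _+_ (f≡0 λ ()) (sum-single (f ∘ suc) r λ r≢i → f≡0 λ { refl → r≢i refl })) (+-identityˡ _)

  -- The cofactors of row `r` do not involve that row, so they are the same for both matrices;
  -- paired with them, every other row of `A` gives 0 and row `r` gives `det A`.
  det-rowCombination : ∀ {n} (A B : Matrix (suc n)) r (v : Fin (suc n) → ℤ) →
    (∀ i k → B (punchIn r i) k ≡ A (punchIn r i) k) →
    (∀ k → B r k ≡ ∑[ i < suc n ] (v i * A i k)) → det B ≡ v r * det A
  det-rowCombination {n} A B r v B≗A Br = begin
    det B
      ≡⟨ laplace B r ⟩
    ∑[ k < suc n ] (B r k * cofactor B r k)
      ≡⟨ sum-cong-≗ (λ k → cong₂ (λ x y → x * (-1ℤ ^ (toℕ r ℕ.+ toℕ k) * y))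
           (Br k) (det-cong λ i j → B≗A i (punchIn k j))) ⟩
    ∑[ k < suc n ] ((∑[ i < suc n ] (v i * A i k)) * cofactor A r k)
      ≡⟨ sum-cong-≗ (λ k → *-distribʳ-sum (cofactor A r k) (λ i → v i * A i k)) ⟩
    ∑[ k < suc n ] ∑[ i < suc n ] (v i * A i k * cofactor A r k)
      ≡⟨ ∑-comm (λ k i → v i * A i k * cofactor A r k) ⟩
    ∑[ i < suc n ] ∑[ k < suc n ] (v i * A i k * cofactor A r k)
      ≡⟨ sum-cong-≗ (λ i → trans
           (sum-cong-≗ λ k → *-assoc (v i) (A i k) (cofactor A r k))
           (sym (*-distribˡ-sum (v i) λ k → A i k * cofactor A r k))) ⟩
    ∑[ i < suc n ] (v i * ∑[ k < suc n ] (A i k * cofactor A r k))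
      ≡⟨ sum-single (λ i → v i * ∑[ k < suc n ] (A i k * cofactor A r k)) r (λ {i} r≢i →
           trans (cong (v i *_) (cofactor-orthogonal A r≢i)) (*-zeroʳ (v i))) ⟩
    v r * ∑[ k < suc n ] (A r k * cofactor A r k)
      ≡⟨ cong (v r *_) (laplace A r) ⟨
    v r * det A ∎

  -- Row and column expansion share the corner term. Expanding the remaining minors once more, along
  -- the first column or the first row, gives the same double sum in the two orders of summation.
  laplaceᶜ : ∀ {n} (A : Matrix (suc n)) → det A ≡ ∑[ i < suc n ] (-1ℤ ^ toℕ i * (A i zero * det (minor A i zero)))
  laplaceᶜ {zero}  A = refl
  laplaceᶜ {suc n} A = cong (_+_ (1ℤ * (A zero zero * det (minor A zero zero)))) (begin
    ∑[ j < suc n ] (s (suc j) * (A zero (suc j) * det (minor A zero (suc j))))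
      ≡⟨ sum-cong-≗ (λ j → trans (cong (λ z → s (suc j) * (A zero (suc j) * z)) (laplaceᶜ (minor A zero (suc j))))
           (trans (sym (*-assoc (s (suc j)) _ _))
             (*-distribˡ-sum (s (suc j) * A zero (suc j)) λ i → s i * (A (suc i) zero * D i j)))) ⟩
    ∑[ j < suc n ] ∑[ i < suc n ] (s (suc j) * A zero (suc j) * (s i * (A (suc i) zero * D i j)))
      ≡⟨ ∑-comm (λ j i → s (suc j) * A zero (suc j) * (s i * (A (suc i) zero * D i j))) ⟩
    ∑[ i < suc n ] ∑[ j < suc n ] (s (suc j) * A zero (suc j) * (s i * (A (suc i) zero * D i j)))
      ≡⟨ sum-cong-≗ (λ i → sum-cong-≗ λ j → lemma (s j) (A zero (suc j)) (s i) (A (suc i) zero) (D i j)) ⟩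
    ∑[ i < suc n ] ∑[ j < suc n ] (s (suc i) * A (suc i) zero * (s j * (A zero (suc j) * D i j)))
      ≡⟨ sum-cong-≗ (λ i → trans
           (sym (*-distribˡ-sum (s (suc i) * A (suc i) zero) λ j → s j * (A zero (suc j) * D i j)))
           (*-assoc (s (suc i)) _ _)) ⟩
    ∑[ i < suc n ] (s (suc i) * (A (suc i) zero * det (minor A (suc i) zero))) ∎)
    where
    s : ∀ {m} → Fin m → ℤ
    s j = -1ℤ ^ toℕ j
    D : Fin (suc n) → Fin (suc n) → ℤ
    D i j = det (λ a b → A (suc (punchIn i a)) (suc (punchIn j b)))
    lemma : ∀ sj a si b d → -1ℤ * sj * a * (si * (b * d)) ≡ -1ℤ * si * b * (sj * (a * d))
    lemma = solve-∀

  det-transpose : ∀ {n} (A : Matrix n) → det (flip A) ≡ det A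
  det-transpose {zero}  A = refl
  det-transpose {suc n} A = trans
    (sum-cong-≗ λ j → cong (λ z → -1ℤ ^ toℕ j * (A j zero * z)) (det-transpose (minor A j zero)))
    (sym (laplaceᶜ A))

  ∣-sum : ∀ {n} d (f : Fin n → ℤ) → (∀ i → d ∣ f i) → d ∣ sum f
  ∣-sum {zero}  d f d∣f = divides 0ℤ refl
  ∣-sum {suc n} d f d∣f = ∣m∣n⇒∣m+n (d∣f zero) (∣-sum d (f ∘ suc) (d∣f ∘ suc))

  ∣-det : ∀ {n} d (A : Matrix (suc n)) r → (∀ k → d ∣ A r k) → d ∣ det A
  ∣-det d A r d∣A = subst (d ∣_) (sym (laplace A r))
    (∣-sum d (λ k → A r k * cofactor A r k) λ k → ∣m⇒∣m*n (cofactor A r k) (d∣A k))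

  onesRow : ∀ {n} → Matrix (suc n) → Matrix (suc n)
  onesRow A zero    k = 1ℤ
  onesRow A (suc i) k = A (suc i) k

  -- The row of ones is minus the sum of all rows of `A`, in which row 0 has coefficient -1.
  det-onesRow-columnSums≡-1 : ∀ {n} (A : Matrix (suc n)) →
    (∀ k → ∑[ i < suc n ] (A i k) ≡ -1ℤ) → det (onesRow A) ≡ - det A
  det-onesRow-columnSums≡-1 {n} A sums = trans
    (det-rowCombination A (onesRow A) zero (λ _ → -1ℤ) (λ _ _ → refl) λ k → begin
      1ℤ                               ≡⟨⟩
      -1ℤ * -1ℤ                        ≡⟨ cong (-1ℤ *_) (sums k) ⟨
      -1ℤ * ∑[ i < suc n ] (A i k)       ≡⟨ *-distribˡ-sum -1ℤ (λ i → A i k) ⟩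
      ∑[ i < suc n ] (-1ℤ * A i k)     ∎)
    (-1*i≡-i (det A))

  -- Adding all columns of `onesRow A` gives the column (n + 1, 0, ..., 0), since only the row of
  -- ones has a nonzero sum. The transpose makes this a row operation.
  det-onesRow-rowSums≡0 : ∀ {n} (A : Matrix (suc n)) →
    (∀ i → ∑[ k < suc n ] (A i k) ≡ 0ℤ) → det (onesRow A) ≡ + suc n * det (minor A zero zero)
  det-onesRow-rowSums≡0 {n} A sums = begin
    det (onesRow A)
      ≡⟨ det-transpose (onesRow A) ⟨
    det B
      ≡⟨ *-identityˡ (det B) ⟨
    1ℤ * det B
      ≡⟨ det-rowCombination B B′ zero (λ _ → 1ℤ) (λ _ _ → refl) B′-row ⟨
    det B′
      ≡⟨ sum-head (λ c → -1ℤ ^ toℕ c * (B′ zero c * det (minor B′ zero c))) (λ c → lemma (-1ℤ ^ toℕ (suc c)) (det (minor B′ zero (suc c)))) ⟩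
    1ℤ * (+ suc n * det (minor B′ zero zero))
      ≡⟨ *-identityˡ _ ⟩
    + suc n * det (minor B′ zero zero)
      ≡⟨ cong (+ suc n *_) (det-transpose (minor A zero zero)) ⟩
    + suc n * det (minor A zero zero) ∎
    where
    B B′ : Matrix (suc n)
    B = flip (onesRow A)
    B′ zero    zero    = + suc n
    B′ zero    (suc k) = 0ℤ
    B′ (suc i) k       = B (suc i) k
    lemma : ∀ x y → x * (0ℤ * y) ≡ 0ℤ
    lemma = solve-∀
    B′-row : ∀ k → B′ zero k ≡ ∑[ i < suc n ] (1ℤ * B i k)
    B′-row zero    = sym (sum-one (suc n))
    B′-row (suc k) = sym (trans (sum-cong-≗ λ i → *-identityˡ (A (suc k) i)) (sums (suc k)))

  -- The shape of the matrix of `T` when χ(d) = -1: its border consists of the symbols of dk² and of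
  -- j².
  record IsBordered {n} (A : Matrix (suc n)) (B : Matrix (suc (suc n))) : Set where
    field
      top   : ∀ k → B zero (suc k) ≡ -1ℤ
      left  : ∀ i → B (suc i) zero ≡ 1ℤ
      inner : ∀ i k → B (suc i) (suc k) ≡ A i k

  -- Replacing row 1 by the sum of all rows below the border gives (n + 1, 0, ..., 0). The minor
  -- that remains is `onesRow A` with its first row negated; this sign cancels against that of the
  -- cofactor at position (1, 0).
  det-bordered-columnSums≡0 : ∀ {n} {A : Matrix (suc n)} {B} → IsBordered A B →
    (∀ k → ∑[ i < suc n ] (A i k) ≡ 0ℤ) → det B ≡ + suc n * det (onesRow A)
  det-bordered-columnSums≡0 {n} {A} {B} bordered sums = begin
    det B
      ≡⟨ *-identityˡ (det B) ⟨
    1ℤ * det B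
      ≡⟨ det-rowCombination B B′ (suc zero) v B′-other B′-row ⟨
    det B′
      ≡⟨ laplace B′ (suc zero) ⟩
    ∑[ c < suc (suc n) ] (B′ (suc zero) c * cofactor B′ (suc zero) c)
      ≡⟨ sum-head (λ c → B′ (suc zero) c * cofactor B′ (suc zero) c) (λ c → *-zeroˡ (cofactor B′ (suc zero) (suc c))) ⟩
    + suc n * cofactor B′ (suc zero) zero
      ≡⟨ cong (λ z → + suc n * (-1ℤ * z)) (begin
           det (minor B′ (suc zero) zero)
             ≡⟨ sum-cong-≗ (λ c → trans
                  (cong₂ (λ x y → -1ℤ ^ toℕ c * (x * y)) (top c) (det-cong λ i k → inner (suc i) (punchIn c k)))
                  (lemma₁ (-1ℤ ^ toℕ c) (det (minor A zero c)))) ⟩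
           ∑[ c < suc n ] (-1ℤ * (-1ℤ ^ toℕ c * (1ℤ * det (minor A zero c))))
             ≡⟨ *-distribˡ-sum -1ℤ (λ c → -1ℤ ^ toℕ c * (1ℤ * det (minor A zero c))) ⟨
           -1ℤ * det (onesRow A) ∎) ⟩
    + suc n * (-1ℤ * (-1ℤ * det (onesRow A)))
      ≡⟨ cong (+ suc n *_) (lemma₂ (det (onesRow A))) ⟩
    + suc n * det (onesRow A) ∎
    where
    open IsBordered bordered
    v : Fin (suc (suc n)) → ℤ
    v zero    = 0ℤ
    v (suc _) = 1ℤ
    B′ : Matrix (suc (suc n))
    B′ zero          k       = B zero k
    B′ (suc zero)    zero    = + suc n
    B′ (suc zero)    (suc k) = 0ℤ
    B′ (suc (suc i)) k       = B (suc (suc i)) k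
    B′-other : ∀ i k → B′ (punchIn (suc zero) i) k ≡ B (punchIn (suc zero) i) k
    B′-other zero    k = refl
    B′-other (suc i) k = refl
    lemma₁ : ∀ x y → x * (-1ℤ * y) ≡ -1ℤ * (x * (1ℤ * y))
    lemma₁ = solve-∀
    lemma₂ : ∀ x → -1ℤ * (-1ℤ * x) ≡ x
    lemma₂ = solve-∀
    combine : ∀ k s → ∑[ i < suc n ] (B (suc i) k) ≡ s → ∑[ i < suc (suc n) ] (v i * B i k) ≡ s
    combine k s eq = begin
      0ℤ * B zero k + ∑[ i < suc n ] (1ℤ * B (suc i) k)
        ≡⟨ cong₂ _+_ (*-zeroˡ (B zero k)) (trans (sum-cong-≗ λ i → *-identityˡ (B (suc i) k)) eq) ⟩
      0ℤ + s
        ≡⟨ +-identityˡ s ⟩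
      s ∎
    B′-row : ∀ k → B′ (suc zero) k ≡ ∑[ i < suc (suc n) ] (v i * B i k)
    B′-row zero    = sym (combine zero (+ suc n) (trans (sum-cong-≗ left) (sum-one (suc n))))
    B′-row (suc k) = sym (combine (suc k) 0ℤ (trans (sum-cong-≗ λ i → inner i k) (sums k)))

-- Sums over initial segments, the binomial theorem and power sums.

module Binomial where

  open import Data.Integer.Base hiding (suc)
  open ≡-Reasoning

  -- Summands are functions on all of ℕ, so ranges can be shifted, split and reversed without casts
  -- between `Fin` types.
  Σ< : ℕ → (ℕ → ℤ) → ℤ
  Σ< n f = ∑[ i < n ] f (toℕ i)

  Σ<-cong : ∀ n {f g : ℕ → ℤ} → (∀ i → f i ≡ g i) → Σ< n f ≡ Σ< n g
  Σ<-cong n f≗g = sum-cong-≗ {n} λ i → f≗g (toℕ i)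

  Σ<-split : ∀ m n f → Σ< (m ℕ.+ n) f ≡ Σ< m f + Σ< n (λ i → f (m ℕ.+ i))
  Σ<-split zero    n f = sym (+-identityˡ _)
  Σ<-split (suc m) n f = trans (cong (_+_ (f 0)) (Σ<-split m n (f ∘ suc))) (sym (+-assoc (f 0) _ _))

  Σ<-last : ∀ n f → Σ< (suc n) f ≡ Σ< n f + f n
  Σ<-last zero    f = +-comm (f 0) 0ℤ
  Σ<-last (suc n) f = trans (cong (_+_ (f 0)) (Σ<-last n (f ∘ suc))) (sym (+-assoc (f 0) _ _))

  Σ<-reverse : ∀ n f → Σ< n f ≡ Σ< n (λ i → f (n ℕ.∸ suc i))
  Σ<-reverse zero    f = refl
  Σ<-reverse (suc n) f = begin
    Σ< (suc n) f     ≡⟨ Σ<-last n f ⟩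
    Σ< n f + f n     ≡⟨ +-comm (Σ< n f) (f n) ⟩
    f n + Σ< n f     ≡⟨ cong (_+_ (f n)) (Σ<-reverse n f) ⟩
    f n + Σ< n (λ i → f (n ℕ.∸ suc i)) ∎

  ^-distribʳ-* : ∀ i j n → (i * j) ^ n ≡ i ^ n * j ^ n
  ^-distribʳ-* i j zero    = refl
  ^-distribʳ-* i j (suc n) = trans (cong (i * j *_) (^-distribʳ-* i j n)) (lemma i j (i ^ n) (j ^ n))
    where
    lemma : ∀ a b c d → a * b * (c * d) ≡ a * c * (b * d)
    lemma = solve-∀

  ^′≡^ : ∀ i n → i ^′ n ≡ i ^ n
  ^′≡^ i zero    = refl
  ^′≡^ i (suc n) = cong (i *_) (^′≡^ i n)

  ·≡* : ∀ n i → n · i ≡ + n * i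
  ·≡* zero    i = refl
  ·≡* (suc n) i = trans (cong (_+_ i) (·≡* n i)) (sym (suc-* (+ n) i))

  binomial : ∀ i j m →
    (i + j) ^ m ≡ Σ< (suc m) (λ k → + (m C k) * (i ^ k * j ^ (m ℕ.∸ k)))
  binomial i j m = begin
    (i + j) ^ m  ≡⟨ ^′≡^ (i + j) m ⟨
    (i + j) ^′ m ≡⟨ BinomialTheorem.theorem +-*-commutativeSemiring m i j ⟩
    ∑[ k < suc m ] ((m C toℕ k) · (i ^′ toℕ k * j ^′ (m ℕ.∸ toℕ k)))
      ≡⟨ sum-cong-≗ {suc m} (λ k → trans (·≡* (m C toℕ k) _)
           (cong₂ (λ x y → + (m C toℕ k) * (x * y)) (^′≡^ i (toℕ k)) (^′≡^ j (m ℕ.∸ toℕ k)))) ⟩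
    Σ< (suc m) (λ k → + (m C k) * (i ^ k * j ^ (m ℕ.∸ k))) ∎

  binomial-1 : ∀ i m → (i + 1ℤ) ^ m ≡ Σ< (suc m) (λ k → + (m C k) * i ^ k)
  binomial-1 i m = trans (binomial i 1ℤ m) (Σ<-cong (suc m) λ k →
    cong (+ (m C k) *_) (trans (cong (i ^ k *_) (^-zeroˡ (m ℕ.∸ k))) (*-identityʳ (i ^ k))))

  -- Pascal's rule reduces both sides to the row above. With `suc n` = p it shows that p divides the
  -- inner binomial coefficients of row p.
  absorption : ∀ n k → suc k ℕ.* (suc n C suc k) ≡ suc n ℕ.* (n C k)
  absorption n zero = begin
    1 ℕ.* (suc n C 1)   ≡⟨ ℕ.*-identityˡ (suc n C 1) ⟩
    suc n C 1           ≡⟨ nC1≡n (suc n) ⟩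
    suc n               ≡⟨ ℕ.*-identityʳ (suc n) ⟨
    suc n ℕ.* 1         ∎
  absorption zero    (suc k) = trans
    (cong (suc (suc k) ℕ.*_) (k>n⇒nCk≡0 {1} {suc (suc k)} (s<s z<s))) (ℕ.*-zeroʳ (suc (suc k)))
  absorption (suc n) (suc k) = begin
    suc (suc k) ℕ.* (suc (suc n) C suc (suc k))
      ≡⟨ cong (suc (suc k) ℕ.*_) (nCk+nC[k+1]≡[n+1]C[k+1] (suc n) (suc k)) ⟨
    suc (suc k) ℕ.* (a ℕ.+ b)
      ≡⟨ lemma₁ k a b ⟩
    suc k ℕ.* a ℕ.+ a ℕ.+ suc (suc k) ℕ.* b
      ≡⟨ cong₂ (λ x y → x ℕ.+ a ℕ.+ y) (absorption n k) (absorption n (suc k)) ⟩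
    suc n ℕ.* (n C k) ℕ.+ a ℕ.+ suc n ℕ.* (n C suc k)
      ≡⟨ lemma₂ n (n C k) (n C suc k) a ⟩
    suc n ℕ.* (n C k ℕ.+ n C suc k) ℕ.+ a
      ≡⟨ cong (λ z → suc n ℕ.* z ℕ.+ a) (nCk+nC[k+1]≡[n+1]C[k+1] n k) ⟩
    suc n ℕ.* a ℕ.+ a
      ≡⟨ ℕ.+-comm (suc n ℕ.* a) a ⟩
    suc (suc n) ℕ.* a ∎
    where
    a = suc n C suc k
    b = suc n C suc (suc k)
    lemma₁ : ∀ k a b → suc (suc k) ℕ.* (a ℕ.+ b) ≡ suc k ℕ.* a ℕ.+ a ℕ.+ suc (suc k) ℕ.* b
    lemma₁ = solve-∀ℕ
    lemma₂ : ∀ n x y a → suc n ℕ.* x ℕ.+ a ℕ.+ suc n ℕ.* y ≡ suc n ℕ.* (x ℕ.+ y) ℕ.+ a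
    lemma₂ = solve-∀ℕ

  -- Both sides are the sum over 0 ≤ x ≤ n, whose term at 0 vanishes because the exponent is
  -- positive.
  Σ<-shift-^ : ∀ n e → Σ< n (λ x → (+ suc x) ^ suc e) ≡ Σ< n (λ x → (+ x) ^ suc e) + (+ n) ^ suc e
  Σ<-shift-^ n e = trans (sym (+-identityˡ _)) (Σ<-last n λ x → (+ x) ^ suc e)

  Σ<-comm : ∀ m n (f : ℕ → ℕ → ℤ) → Σ< m (λ i → Σ< n (f i)) ≡ Σ< n (λ j → Σ< m (λ i → f i j))
  Σ<-comm m n f = ∑-comm {m} {n} λ i j → f (toℕ i) (toℕ j)

  Σ<-*ˡ : ∀ n i f → Σ< n (λ k → i * f k) ≡ i * Σ< n f
  Σ<-*ˡ n i f = sym (*-distribˡ-sum {n} i λ k → f (toℕ k))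

  -- Sum (x + 1) ^ (e + 1) - x ^ (e + 1) over x < n in two ways.
  Σ<-power : ∀ n e → (+ n) ^ suc e ≡ Σ< (suc e) (λ k → + (suc e C k) * Σ< n (λ x → (+ x) ^ k))
  Σ<-power n e = ∙-cancelˡ +-0-abelianGroup (P m) ((+ n) ^ m) (Σ< m g) (trans chain (+-comm (Σ< m g) (P m)))
    where
    m = suc e
    P g : ℕ → ℤ
    P k = Σ< n (λ x → (+ x) ^ k)
    g k = + (m C k) * P k
    chain : P m + (+ n) ^ m ≡ Σ< m g + P m
    chain = begin
      P m + (+ n) ^ m
        ≡⟨ Σ<-shift-^ n e ⟨
      Σ< n (λ x → (+ suc x) ^ m)
        ≡⟨ Σ<-cong n (λ x → trans (cong (λ z → (+ z) ^ m) (ℕ.+-comm 1 x)) (binomial-1 (+ x) m)) ⟩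
      Σ< n (λ x → Σ< (suc m) (λ k → + (m C k) * (+ x) ^ k))
        ≡⟨ Σ<-comm n (suc m) (λ x k → + (m C k) * (+ x) ^ k) ⟩
      Σ< (suc m) (λ k → Σ< n (λ x → + (m C k) * (+ x) ^ k))
        ≡⟨ Σ<-cong (suc m) (λ k → Σ<-*ˡ n (+ (m C k)) (λ x → (+ x) ^ k)) ⟩
      Σ< (suc m) g
        ≡⟨ Σ<-last m g ⟩
      Σ< m g + + (m C m) * P m
        ≡⟨ cong (λ z → Σ< m g + + z * P m) (nCn≡1 m) ⟩
      Σ< m g + 1ℤ * P m
        ≡⟨ cong (_+_ (Σ< m g)) (*-identityˡ (P m)) ⟩
      Σ< m g + P m ∎

  [1+n]Cn≡1+n : ∀ n → suc n C n ≡ suc n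
  [1+n]Cn≡1+n n = trans (nCk≡nC[n∸k] (ℕ.n≤1+n n)) (trans (cong (suc n C_) (ℕ.m+n∸n≡m 1 n)) (nC1≡n (suc n)))

  0^1+n : ∀ n → 0ℤ ^ suc n ≡ 0ℤ
  0^1+n n = *-zeroˡ (0ℤ ^ n)

  ∣Σ<∣≤ : ∀ n f → (∀ i → ∣ f i ∣ ℕ.≤ 1) → ∣ Σ< n f ∣ ℕ.≤ n
  ∣Σ<∣≤ zero    f f≤1 = z≤n
  ∣Σ<∣≤ (suc n) f f≤1 = ℕ.≤-trans (∣i+j∣≤∣i∣+∣j∣ (f 0) _) (ℕ.+-mono-≤ (f≤1 0) (∣Σ<∣≤ n (f ∘ suc) (f≤1 ∘ suc)))

-- Congruence modulo p and the values of the Legendre symbol.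

module Congruence (p : ℕ) where

  open import Data.Integer.Base hiding (suc)
  open Binomial

  infix 4 _≈_
  -- A record, not a synonym for divisibility of the difference, so that both sides can be inferred
  -- from a proof.
  record _≈_ (i j : ℤ) : Set where
    constructor ∣⇒≈
    field ≈⇒∣ : + p ∣ i - j
  open _≈_ public

  ≈-refl : ∀ {i} → i ≈ i
  ≈-refl {i} = ∣⇒≈ (subst (+ p ∣_) (sym (+-inverseʳ i)) (divides 0ℤ refl))

  ≈-reflexive : ∀ {i j} → i ≡ j → i ≈ j
  ≈-reflexive refl = ≈-refl

  ≈-sym : ∀ {i j} → i ≈ j → j ≈ i
  ≈-sym {i} {j} (∣⇒≈ d) = ∣⇒≈ (subst (+ p ∣_) (lemma i j) (∣m⇒∣-m d))
    where
    lemma : ∀ i j → - (i - j) ≡ j - i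
    lemma = solve-∀

  ≈-trans : ∀ {i j k} → i ≈ j → j ≈ k → i ≈ k
  ≈-trans {i} {j} {k} (∣⇒≈ d) (∣⇒≈ e) = ∣⇒≈ (subst (+ p ∣_) (lemma i j k) (∣m∣n⇒∣m+n d e))
    where
    lemma : ∀ i j k → (i - j) + (j - k) ≡ i - k
    lemma = solve-∀

  ≈-setoid : Setoid 0ℓ 0ℓ
  ≈-setoid = record
    { Carrier = ℤ ; _≈_ = _≈_
    ; isEquivalence = record { refl = ≈-refl ; sym = ≈-sym ; trans = ≈-trans } }

  +-cong : ∀ {i j k l} → i ≈ j → k ≈ l → i + k ≈ j + l
  +-cong {i} {j} {k} {l} (∣⇒≈ d) (∣⇒≈ e) = ∣⇒≈ (subst (+ p ∣_) (lemma i j k l) (∣m∣n⇒∣m+n d e))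
    where
    lemma : ∀ i j k l → (i - j) + (k - l) ≡ (i + k) - (j + l)
    lemma = solve-∀

  *-cong : ∀ {i j k l} → i ≈ j → k ≈ l → i * k ≈ j * l
  *-cong {i} {j} {k} {l} (∣⇒≈ d) (∣⇒≈ e) =
    ∣⇒≈ (subst (+ p ∣_) (lemma i j k l) (∣m∣n⇒∣m+n (∣n⇒∣m*n k d) (∣n⇒∣m*n j e)))
    where
    lemma : ∀ i j k l → k * (i - j) + j * (k - l) ≡ i * k - j * l
    lemma = solve-∀

  -‿cong : ∀ {i j} → i ≈ j → - i ≈ - j
  -‿cong {i} {j} d = subst₂ _≈_ (-1*i≡-i i) (-1*i≡-i j) (*-cong (≈-refl { -1ℤ }) d)

  +-congˡ : ∀ i {j k} → j ≈ k → i + j ≈ i + k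
  +-congˡ i = +-cong (≈-refl {i})

  +-congʳ : ∀ i {j k} → j ≈ k → j + i ≈ k + i
  +-congʳ i d = +-cong d (≈-refl {i})

  *-congˡ : ∀ i {j k} → j ≈ k → i * j ≈ i * k
  *-congˡ i = *-cong (≈-refl {i})

  *-congʳ : ∀ i {j k} → j ≈ k → j * i ≈ k * i
  *-congʳ i d = *-cong d (≈-refl {i})

  ^-cong : ∀ n {i j} → i ≈ j → i ^ n ≈ j ^ n
  ^-cong zero    d = ≈-refl
  ^-cong (suc n) d = *-cong d (^-cong n d)

  ∣⇒≈0 : ∀ {i} → + p ∣ i → i ≈ 0ℤ
  ∣⇒≈0 {i} d = ∣⇒≈ (subst (+ p ∣_) (sym (+-identityʳ i)) d)

  ≈0⇒∣ : ∀ {i} → i ≈ 0ℤ → + p ∣ i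
  ≈0⇒∣ {i} (∣⇒≈ d) = subst (+ p ∣_) (+-identityʳ i) d

  i-j≈0⇒i≈j : ∀ {i j} → i - j ≈ 0ℤ → i ≈ j
  i-j≈0⇒i≈j d = ∣⇒≈ (≈0⇒∣ d)

  p≈0 : + p ≈ 0ℤ
  p≈0 = ∣⇒≈0 ∣-refl

  Σ<-cong-≈ : ∀ n {f g} → (∀ i → i ℕ.< n → f i ≈ g i) → Σ< n f ≈ Σ< n g
  Σ<-cong-≈ zero    f≈g = ≈-refl
  Σ<-cong-≈ (suc n) f≈g = +-cong (f≈g 0 z<s) (Σ<-cong-≈ n λ i i<n → f≈g (suc i) (s<s i<n))

  Σ<-≈0 : ∀ n f → (∀ i → i ℕ.< n → f i ≈ 0ℤ) → Σ< n f ≈ 0ℤ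
  Σ<-≈0 n f f≈0 = ≈-trans (Σ<-cong-≈ n f≈0) (≈-reflexive (sum-replicate-zero n))

  Σ<-≈head : ∀ n f → (∀ i → i ℕ.< n → f (suc i) ≈ 0ℤ) → Σ< (suc n) f ≈ f 0
  Σ<-≈head n f f≈0 = ≈-trans (+-congˡ (f 0) (Σ<-≈0 n (f ∘ suc) f≈0)) (≈-reflexive (+-identityʳ (f 0)))

  legendre-cases : ∀ a →
    (+ p ∣ a × legendre a p ≡ 0ℤ)
    ⊎ (¬ + p ∣ a × IsSquareMod p a × legendre a p ≡ 1ℤ)
    ⊎ (¬ + p ∣ a × ¬ IsSquareMod p a × legendre a p ≡ -1ℤ)
  legendre-cases a = cases (+ p ∣? a) (isSquareMod? p a)
    where
    -- With the two decisions as variables, matching on them evaluates the nested conditional.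
    cases : (p∣a? : Dec (+ p ∣ a)) (sq? : Dec (IsSquareMod p a)) →
      let l = if does p∣a? then 0ℤ else if does sq? then 1ℤ else -1ℤ in
      (+ p ∣ a × l ≡ 0ℤ)
      ⊎ (¬ + p ∣ a × IsSquareMod p a × l ≡ 1ℤ)
      ⊎ (¬ + p ∣ a × ¬ IsSquareMod p a × l ≡ -1ℤ)
    cases (yes p∣a) _        = inj₁ (p∣a , refl)
    cases (no  p∤a) (yes sq) = inj₂ (inj₁ (p∤a , sq , refl))
    cases (no  p∤a) (no ¬sq) = inj₂ (inj₂ (p∤a , ¬sq , refl))

  ∣legendre∣≤1 : ∀ a → ∣ legendre a p ∣ ℕ.≤ 1
  ∣legendre∣≤1 a with legendre-cases a
  ... | inj₁ (_ , eq)            rewrite eq = z≤n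
  ... | inj₂ (inj₁ (_ , _ , eq)) rewrite eq = ℕ.≤-refl
  ... | inj₂ (inj₂ (_ , _ , eq)) rewrite eq = ℕ.≤-refl

-- From integer identities to identities with rational factors.

module Rational where

  open import Data.Integer.Base using (+_; _*_)

  toℚᵘ-/ : ∀ i n → ℚ.toℚᵘ (i ℚ./ suc n) ℚᵘ.≃ ℚᵘ.mkℚᵘ i n
  toℚᵘ-/ i n = toℚᵘ-fromℚᵘ (ℚᵘ.mkℚᵘ i n)

  -- Among unnormalised fractions the claim is a cross-multiplication, with no reduction to lowest
  -- terms.
  /-*-fromℤ : ∀ i n j k → i * j ≡ k * + suc n → (i ℚ./ suc n) ℚ.* fromℤ j ≡ fromℤ k
  /-*-fromℤ i n j k eq = toℚᵘ-injective (begin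
    ℚ.toℚᵘ ((i ℚ./ suc n) ℚ.* fromℤ j)
      ≈⟨ toℚᵘ-homo-* (i ℚ./ suc n) (fromℤ j) ⟩
    ℚ.toℚᵘ (i ℚ./ suc n) ℚᵘ.* ℚ.toℚᵘ (fromℤ j)
      ≈⟨ ℚᵘ.*-cong (toℚᵘ-/ i n) (toℚᵘ-/ j 0) ⟩
    ℚᵘ.mkℚᵘ i n ℚᵘ.* ℚᵘ.mkℚᵘ j 0
      ≈⟨ ℚᵘ.*≡* (trans (*-identityʳ (i * j)) (trans eq (cong (λ z → k * + z) (sym (ℕ.*-identityʳ (suc n)))))) ⟩
    ℚᵘ.mkℚᵘ k 0
      ≈⟨ toℚᵘ-/ k 0 ⟨
    ℚ.toℚᵘ (fromℤ k) ∎)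
    where open ℚᵘ.≃-Reasoning

-- Writing p as 2n + 1.

even-or-odd : ∀ m → (∃ λ k → m ≡ k ℕ.+ k) ⊎ (∃ λ k → m ≡ suc (k ℕ.+ k))
even-or-odd zero = inj₁ (0 , refl)
even-or-odd (suc m) with even-or-odd m
... | inj₁ (k , refl) = inj₂ (k , refl)
... | inj₂ (k , refl) = inj₁ (suc k , cong suc (sym (ℕ.+-suc k k)))

k+k≡k*2 : ∀ k → k ℕ.+ k ≡ k ℕ.* 2
k+k≡k*2 = solve-∀ℕ

-- In this form `p ∸ 1` reduces to n + n, and n is visibly a successor, so the matrices of order n
-- have a first row.
prime>3⇒odd : ∀ {p} → Prime p → p ℕ.> 3 → ∃ λ k → p ≡ suc (suc k ℕ.+ suc k)
prime>3⇒odd {p} p-prime p>3 with even-or-odd p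
... | inj₂ (suc k , eq)  = k , eq
... | inj₂ (zero , refl) = contradiction p>3 λ { (s≤s ()) }
... | inj₁ (k , eq) with prime⇒irreducible p-prime (ℕ.divides k (trans eq (k+k≡k*2 k)))
...   | inj₁ ()
...   | inj₂ refl = contradiction p>3 λ { (s≤s (s≤s ())) }

half-odd : ∀ k → half (suc (k ℕ.+ k)) ≡ k
half-odd k = trans (cong (ℕ._/ 2) (k+k≡k*2 k)) (m*n/n≡m k 2)

-- Fermat's little theorem and power sums modulo p = 2n + 1.

module OddPrime (n′ : ℕ) (p-prime : Prime (suc (suc n′ ℕ.+ suc n′))) where

  n p : ℕ
  n = suc n′
  p = suc (n ℕ.+ n)

  open import Data.Integer.Base hiding (suc)
  open Determinant
  open Binomial
  open Congruence p
  open Rational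
  open SetoidReasoning ≈-setoid

  euclid : ∀ i j → + p ∣ i * j → (+ p ∣ i) ⊎ (+ p ∣ j)
  euclid i j d with euclidsLemma ∣ i ∣ ∣ j ∣ p-prime (subst (p ℕ.∣_) (abs-* i j) (∣⇒∣ᵤ d))
  ... | inj₁ e = inj₁ (∣ᵤ⇒∣ e)
  ... | inj₂ e = inj₂ (∣ᵤ⇒∣ e)

  *-cancelˡ-≈0 : ∀ i {j} → ¬ + p ∣ i → i * j ≈ 0ℤ → j ≈ 0ℤ
  *-cancelˡ-≈0 i {j} p∤i ij≈0 with euclid i j (≈0⇒∣ ij≈0)
  ... | inj₁ p∣i = contradiction p∣i p∤i
  ... | inj₂ p∣j = ∣⇒≈0 p∣j

  ∤-small : ∀ {k} → suc k ℕ.< p → ¬ + p ∣ + suc k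
  ∤-small k<p d = ℕ.>⇒∤ k<p (∣⇒∣ᵤ d)

  ≈⇒≡ : ∀ {i j} → ∣ i - j ∣ ℕ.< p → i ≈ j → i ≡ j
  ≈⇒≡ {i} {j} small i≈j with ∣ i - j ∣ in eq
  ... | zero  = i-j≡0⇒i≡j i j (∣i∣≡0⇒i≡0 eq)
  ... | suc k = contradiction (subst (p ℕ.∣_) eq (∣⇒∣ᵤ (≈⇒∣ i≈j))) (ℕ.>⇒∤ small)

  pCk≈0 : ∀ k → suc k ℕ.< p → + (p C suc k) ≈ 0ℤ
  pCk≈0 k k<p = *-cancelˡ-≈0 (+ suc k) (∤-small k<p) (begin
    + suc k * + (p C suc k)    ≡⟨ pos-* (suc k) (p C suc k) ⟨
    + (suc k ℕ.* (p C suc k))  ≡⟨ cong +_ (absorption (n ℕ.+ n) k) ⟩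
    + (p ℕ.* ((n ℕ.+ n) C k))  ≡⟨ pos-* p ((n ℕ.+ n) C k) ⟩
    + p * + ((n ℕ.+ n) C k)    ≈⟨ *-congʳ (+ ((n ℕ.+ n) C k)) p≈0 ⟩
    0ℤ * + ((n ℕ.+ n) C k)     ≡⟨ *-zeroˡ (+ ((n ℕ.+ n) C k)) ⟩
    0ℤ ∎)

  -- Induction on `x`: modulo p only the two outer terms of the expansion of (x + 1)^p survive.
  fermat-ℕ : ∀ x → (+ x) ^ p ≈ + x
  fermat-ℕ zero    = ≈-reflexive (0^1+n (n ℕ.+ n))
  fermat-ℕ (suc x) = begin
    (+ suc x) ^ p        ≡⟨ cong (λ z → (+ z) ^ p) (ℕ.+-comm 1 x) ⟩
    (+ x + 1ℤ) ^ p     ≡⟨ binomial-1 (+ x) p ⟩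
    Σ< (suc p) f       ≡⟨ Σ<-last p f ⟩
    Σ< p f + f p       ≈⟨ +-cong (Σ<-≈head (n ℕ.+ n) f (λ k k<2n →
                             ≈-trans (*-congʳ ((+ x) ^ suc k) (pCk≈0 k (s<s k<2n))) (≈-reflexive (*-zeroˡ ((+ x) ^ suc k)))))
                           (≈-reflexive (cong (λ z → + z * (+ x) ^ p) (nCn≡1 p))) ⟩
    1ℤ + 1ℤ * (+ x) ^ p  ≡⟨ cong (_+_ 1ℤ) (*-identityˡ ((+ x) ^ p)) ⟩
    1ℤ + (+ x) ^ p       ≈⟨ +-congˡ 1ℤ (fermat-ℕ x) ⟩
    1ℤ + + x           ∎
    where
    f : ℕ → ℤ
    f k = + (p C k) * (+ x) ^ k

  fermat : ∀ i → i ^ p ≈ i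
  fermat i = begin
    i ^ p  ≈⟨ ^-cong p i≈r ⟩
    r ^ p  ≈⟨ fermat-ℕ (i %ℕ p) ⟩
    r      ≈⟨ i≈r ⟨
    i      ∎
    where
    r = + (i %ℕ p)
    lemma : ∀ r q p → (r + q * p) - r ≡ q * p
    lemma = solve-∀
    i≈r : i ≈ r
    i≈r = ∣⇒≈ (divides (i /ℕ p) (trans (cong (_- r) (a≡a%ℕn+[a/ℕn]*n i p)) (lemma r (i /ℕ p) (+ p))))

  fermat-unit : ∀ i → ¬ + p ∣ i → i ^ (n ℕ.+ n) ≈ 1ℤ
  fermat-unit i p∤i = i-j≈0⇒i≈j (*-cancelˡ-≈0 i p∤i (∣⇒≈0 (subst (+ p ∣_) (lemma i (i ^ (n ℕ.+ n))) (≈⇒∣ (fermat i)))))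
    where
    lemma : ∀ i x → i * x - i ≡ i * (x - 1ℤ)
    lemma = solve-∀

  powerSum : ℕ → ℤ
  powerSum e = Σ< p (λ x → (+ x) ^ e)

  -- In `Σ<-power p e` the left side is a multiple of p and the terms k < e vanish by induction.
  -- What remains is e + 1 times the sum in question. The case e = 0 is included, with 0^0 = 1.
  powerSum≈0 : ∀ e → suc e ℕ.< p → powerSum e ≈ 0ℤ
  powerSum≈0 = <-rec (λ e → suc e ℕ.< p → powerSum e ≈ 0ℤ) λ e rec e<p →
    *-cancelˡ-≈0 (+ suc e) (∤-small e<p) (begin
      + suc e * powerSum e
        ≡⟨ cong (λ z → + z * powerSum e) ([1+n]Cn≡1+n e) ⟨
      g e e
        ≡⟨ +-identityˡ (g e e) ⟨
      0ℤ + g e e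
        ≈⟨ +-congʳ (g e e) (Σ<-≈0 e (g e) λ k k<e →
             ≈-trans (*-congˡ (+ (suc e C k)) (rec k<e (ℕ.<-trans (s<s k<e) e<p))) (≈-reflexive (*-zeroʳ (+ (suc e C k))))) ⟨
      Σ< e (g e) + g e e
        ≡⟨ Σ<-last e (g e) ⟨
      Σ< (suc e) (g e)
        ≡⟨ Σ<-power p e ⟨
        (+ p) ^ suc e
          ≈⟨ ∣⇒≈0 (∣m⇒∣m*n ((+ p) ^ e) ∣-refl) ⟩
      0ℤ ∎)
    where
    g : ℕ → ℕ → ℤ
    g e k = + (suc e C k) * powerSum k

  half≡n : half p ≡ n
  half≡n = half-odd n

  sq : ℕ → ℤ
  sq j = (+ suc j) ^ 2

  halfSum : ℕ → ℤ
  halfSum i = Σ< n (λ j → sq j ^ i)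

  p∤1+j : ∀ j → j ℕ.< n → ¬ + p ∣ + suc j
  p∤1+j j j<n = ∤-small (s<s (ℕ.<-≤-trans j<n (ℕ.m≤m+n n n)))

  p∤n : ¬ + p ∣ + n
  p∤n = p∤1+j n′ ℕ.≤-refl

  -- Reversal pairs each x in the upper half with p - x in the lower half, and the two have
  -- congruent squares. The term x = 0 drops out because the exponent is positive.
  powerSum-fold : ∀ i → powerSum (2 ℕ.* suc i) ≈ + 2 * halfSum (suc i)
  powerSum-fold i = begin
    powerSum (2 ℕ.* suc i)
      ≡⟨ Σ<-cong p (λ x → sym (^-*-assoc (+ x) 2 (suc i))) ⟩
    0ℤ ^ suc i + Σ< (n ℕ.+ n) (λ x → f (suc x))
      ≡⟨ cong₂ _+_ (0^1+n i) (Σ<-split n n (λ x → f (suc x))) ⟩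
    0ℤ + (Σ< n (λ x → f (suc x)) + Σ< n (λ x → f (suc (n ℕ.+ x))))
      ≡⟨ +-identityˡ _ ⟩
    Σ< n (λ x → f (suc x)) + Σ< n (λ x → f (suc (n ℕ.+ x)))
      ≡⟨ cong (_+_ (halfSum (suc i))) (Σ<-reverse n (λ x → f (suc (n ℕ.+ x)))) ⟩
    halfSum (suc i) + Σ< n (λ x → f (suc (n ℕ.+ (n ℕ.∸ suc x))))
      ≈⟨ +-congˡ (halfSum (suc i)) (Σ<-cong-≈ n λ x x<n → ^-cong (suc i) (reflect x x<n)) ⟩
    halfSum (suc i) + halfSum (suc i)
      ≡⟨ double (halfSum (suc i)) ⟩
    + 2 * halfSum (suc i) ∎
    where
    f : ℕ → ℤ
    f x = ((+ x) ^ 2) ^ suc i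
    double : ∀ x → x + x ≡ + 2 * x
    double = solve-∀
    reflect : ∀ x → x ℕ.< n → (+ suc (n ℕ.+ (n ℕ.∸ suc x))) ^ 2 ≈ sq x
    reflect x x<n = ∣⇒≈ (subst (+ p ∣_) (trans (cong (_* (a - b)) p≡a+b) (lemma a b)) (∣m⇒∣m*n (a - b) ∣-refl))
      where
      a = + suc (n ℕ.+ (n ℕ.∸ suc x))
      b = + suc x
      p≡a+b : + p ≡ a + b
      p≡a+b = cong (λ z → + suc z) (trans (cong (n ℕ.+_) (sym (ℕ.m∸n+n≡m x<n))) (sym (ℕ.+-assoc n (n ℕ.∸ suc x) (suc x))))
      lemma : ∀ a b → (a + b) * (a - b) ≡ a * (a * 1ℤ) - b * (b * 1ℤ)
      lemma = solve-∀

  halfSum≈0 : ∀ i → suc i ℕ.< n → halfSum (suc i) ≈ 0ℤ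
  halfSum≈0 i i<n = *-cancelˡ-≈0 (+ 2) (∤-small (s<s (s<s (ℕ.≤-trans z<s (ℕ.m≤n+m n n′)))))
    (≈-trans (≈-sym (powerSum-fold i)) (powerSum≈0 (2 ℕ.* suc i) (s<s 2i<2n)))
    where
    2i<2n : 2 ℕ.* suc i ℕ.< n ℕ.+ n
    2i<2n = subst (λ z → suc i ℕ.+ z ℕ.< n ℕ.+ n) (sym (ℕ.+-identityʳ (suc i))) (ℕ.+-mono-< i<n i<n)

  sq^n≈1 : ∀ j → j ℕ.< n → sq j ^ n ≈ 1ℤ
  sq^n≈1 j j<n = begin
    sq j ^ n               ≡⟨ ^-*-assoc (+ suc j) 2 n ⟩
    (+ suc j) ^ (2 ℕ.* n)  ≡⟨ cong (λ z → (+ suc j) ^ (n ℕ.+ z)) (ℕ.+-identityʳ n) ⟩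
    (+ suc j) ^ (n ℕ.+ n)  ≈⟨ fermat-unit (+ suc j) (p∤1+j j j<n) ⟩
    1ℤ                     ∎

  halfSum-periodic : ∀ i → halfSum (n ℕ.+ i) ≈ halfSum i
  halfSum-periodic i = Σ<-cong-≈ n λ j j<n → begin
    sq j ^ (n ℕ.+ i)     ≡⟨ ^-distribˡ-+-* (sq j) n i ⟩
    sq j ^ n * sq j ^ i  ≈⟨ *-congʳ (sq j ^ i) (sq^n≈1 j j<n) ⟩
    1ℤ * sq j ^ i        ≡⟨ *-identityˡ (sq j ^ i) ⟩
    sq j ^ i             ∎

  -- `halfSum i` vanishes modulo p for 0 < i < n, while `halfSum 0` counts its n terms.
  Σ<-halfSum : ∀ t → t ℕ.< n → (c : ℕ → ℤ) → Σ< (suc t) (λ i → c i * halfSum i) ≈ c 0 * + n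
  Σ<-halfSum t t<n c = ≈-trans
    (Σ<-≈head t (λ i → c i * halfSum i) λ i i<t →
      ≈-trans (*-congˡ (c (suc i)) (halfSum≈0 i (ℕ.≤-<-trans i<t t<n))) (≈-reflexive (*-zeroʳ (c (suc i)))))
    (≈-reflexive (cong (c 0 *_) (sum-one n)))

  module _ (u w : ℤ) (t : ℕ) where

    coeff : ℕ → ℤ
    coeff k = + ((n ℕ.+ t) C k) * (u ^ k * w ^ (n ℕ.+ t ℕ.∸ k))

    -- The binomial index splits into k < n, of which only k = 0 survives, and k = n + i, where
    -- periodicity lowers the exponent to i. The second block is left unevaluated because it behaves
    -- differently for t < n and for t = n.
    powerSum-quadratic-expand :
      Σ< n (λ j → (u * sq j + w) ^ (n ℕ.+ t)) ≈ coeff 0 * + n + Σ< (suc t) (λ i → coeff (n ℕ.+ i) * halfSum i)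
    powerSum-quadratic-expand = begin
      Σ< n (λ j → (u * sq j + w) ^ m)
        ≡⟨ Σ<-cong n (λ j → binomial (u * sq j) w m) ⟩
      Σ< n (λ j → Σ< (suc m) (λ k → + (m C k) * ((u * sq j) ^ k * w ^ (m ℕ.∸ k))))
        ≡⟨ Σ<-comm n (suc m) (λ j k → + (m C k) * ((u * sq j) ^ k * w ^ (m ℕ.∸ k))) ⟩
      Σ< (suc m) (λ k → Σ< n (λ j → + (m C k) * ((u * sq j) ^ k * w ^ (m ℕ.∸ k))))
        ≡⟨ Σ<-cong (suc m) (λ k → trans
             (Σ<-cong n λ j → trans
               (cong (λ z → + (m C k) * (z * w ^ (m ℕ.∸ k))) (^-distribʳ-* u (sq j) k))
               (lemma (+ (m C k)) (u ^ k) (sq j ^ k) (w ^ (m ℕ.∸ k))))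
             (Σ<-*ˡ n (coeff k) (λ j → sq j ^ k))) ⟩
      Σ< (suc m) g
        ≡⟨ cong (λ z → Σ< z g) (ℕ.+-suc n t) ⟨
      Σ< (n ℕ.+ suc t) g
        ≡⟨ Σ<-split n (suc t) g ⟩
      Σ< n g + Σ< (suc t) (λ i → g (n ℕ.+ i))
        ≈⟨ +-cong (Σ<-halfSum n′ ℕ.≤-refl coeff)
             (Σ<-cong-≈ (suc t) λ i _ → *-congˡ (coeff (n ℕ.+ i)) (halfSum-periodic i)) ⟩
      coeff 0 * + n + Σ< (suc t) (λ i → coeff (n ℕ.+ i) * halfSum i) ∎
      where
      m = n ℕ.+ t
      g : ℕ → ℤ
      g k = coeff k * halfSum k
      lemma : ∀ c a s b → c * ((a * s) * b) ≡ c * (a * b) * s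
      lemma = solve-∀

    coeff-0 : coeff 0 ≡ w ^ (n ℕ.+ t)
    coeff-0 = trans (*-identityˡ _) (*-identityˡ _)

    coeff-n : coeff (n ℕ.+ 0) ≡ + ((n ℕ.+ t) C n) * (u ^ n * w ^ t)
    coeff-n = trans (cong coeff (ℕ.+-identityʳ n))
      (cong (λ z → + ((n ℕ.+ t) C n) * (u ^ n * w ^ z)) (ℕ.m+n∸m≡n n t))

  powerSum-quadratic : ∀ u w t → t ℕ.< n →
    Σ< n (λ j → (u * sq j + w) ^ (n ℕ.+ t)) ≈ + n * (w ^ (n ℕ.+ t) + + ((n ℕ.+ t) C n) * (u ^ n * w ^ t))
  powerSum-quadratic u w t t<n = begin
    Σ< n (λ j → (u * sq j + w) ^ (n ℕ.+ t))
      ≈⟨ powerSum-quadratic-expand u w t ⟩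
    c 0 * + n + Σ< (suc t) (λ i → c (n ℕ.+ i) * halfSum i)
      ≈⟨ +-congˡ (c 0 * + n) (Σ<-halfSum t t<n (λ i → c (n ℕ.+ i))) ⟩
    c 0 * + n + c (n ℕ.+ 0) * + n
      ≡⟨ cong₂ (λ x y → x * + n + y * + n) (coeff-0 u w t) (coeff-n u w t) ⟩
    w ^ (n ℕ.+ t) * + n + + ((n ℕ.+ t) C n) * (u ^ n * w ^ t) * + n
      ≡⟨ lemma (w ^ (n ℕ.+ t)) (+ ((n ℕ.+ t) C n) * (u ^ n * w ^ t)) (+ n) ⟩
    + n * (w ^ (n ℕ.+ t) + + ((n ℕ.+ t) C n) * (u ^ n * w ^ t)) ∎
    where
    c = coeff u w t
    lemma : ∀ x y n → x * n + y * n ≡ n * (x + y)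
    lemma = solve-∀

  -- At t = n the second block reaches i = n, where `halfSum n` is again congruent to n; this
  -- contributes the additional term u^(2n).
  powerSum-quadratic-top : ∀ u w →
    Σ< n (λ j → (u * sq j + w) ^ (n ℕ.+ n))
      ≈ + n * (w ^ (n ℕ.+ n) + + ((n ℕ.+ n) C n) * (u ^ n * w ^ n) + u ^ (n ℕ.+ n))
  powerSum-quadratic-top u w = begin
    Σ< n (λ j → (u * sq j + w) ^ (n ℕ.+ n))
      ≈⟨ powerSum-quadratic-expand u w n ⟩
    c 0 * + n + Σ< (suc n) (λ i → c (n ℕ.+ i) * halfSum i)
      ≡⟨ cong (_+_ (c 0 * + n)) (Σ<-last n (λ i → c (n ℕ.+ i) * halfSum i)) ⟩
    c 0 * + n + (Σ< n (λ i → c (n ℕ.+ i) * halfSum i) + c (n ℕ.+ n) * halfSum n)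
      ≈⟨ +-congˡ (c 0 * + n) (+-cong (Σ<-halfSum n′ ℕ.≤-refl (λ i → c (n ℕ.+ i))) (*-congˡ (c (n ℕ.+ n)) halfSum-n)) ⟩
    c 0 * + n + (c (n ℕ.+ 0) * + n + c (n ℕ.+ n) * + n)
      ≡⟨ cong₂ (λ x y → x * + n + y) (coeff-0 u w n) (cong₂ (λ x y → x * + n + y * + n) (coeff-n u w n) coeff-2n) ⟩
    w ^ (n ℕ.+ n) * + n + (+ ((n ℕ.+ n) C n) * (u ^ n * w ^ n) * + n + u ^ (n ℕ.+ n) * + n)
      ≡⟨ lemma (w ^ (n ℕ.+ n)) (+ ((n ℕ.+ n) C n) * (u ^ n * w ^ n)) (u ^ (n ℕ.+ n)) (+ n) ⟩
    + n * (w ^ (n ℕ.+ n) + + ((n ℕ.+ n) C n) * (u ^ n * w ^ n) + u ^ (n ℕ.+ n)) ∎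
    where
    c = coeff u w n
    halfSum-n : halfSum n ≈ + n
    halfSum-n = begin
      halfSum n          ≡⟨ cong halfSum (ℕ.+-identityʳ n) ⟨
      halfSum (n ℕ.+ 0)  ≈⟨ halfSum-periodic 0 ⟩
      halfSum 0          ≡⟨ sum-one n ⟩
      + n                ∎
    coeff-2n : c (n ℕ.+ n) ≡ u ^ (n ℕ.+ n)
    coeff-2n = trans (cong₂ (λ x y → + x * (u ^ (n ℕ.+ n) * w ^ y)) (nCn≡1 (n ℕ.+ n)) (ℕ.n∸n≡0 (n ℕ.+ n)))
      (trans (*-identityˡ _) (*-identityʳ _))
    lemma : ∀ x y z n → x * n + (y * n + z * n) ≡ n * (x + y + z)
    lemma = solve-∀

  -- Euler's criterion.

  -- Neighbouring entries of row p - 1 of Pascal's triangle add up to an inner entry of row p, a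
  -- multiple of p, so they alternate in sign.
  [p-1]Ck≈±1 : ∀ k → k ℕ.< p → + ((n ℕ.+ n) C k) ≈ -1ℤ ^ k
  [p-1]Ck≈±1 zero    k<p = ≈-refl
  [p-1]Ck≈±1 (suc k) k<p = begin
    + b             ≡⟨ lemma₁ (+ a) (+ b) ⟩
    (+ a + + b) - + a
      ≡⟨ cong (λ z → + z - + a) (nCk+nC[k+1]≡[n+1]C[k+1] (n ℕ.+ n) k) ⟩
    + (p C suc k) - + a
      ≈⟨ +-cong (pCk≈0 k k<p) (-‿cong ([p-1]Ck≈±1 k (ℕ.<-trans (ℕ.n<1+n k) k<p))) ⟩
    0ℤ - (-1ℤ ^ k)  ≡⟨ lemma₂ (-1ℤ ^ k) ⟩
    -1ℤ * -1ℤ ^ k   ∎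
    where
    a = (n ℕ.+ n) C k
    b = (n ℕ.+ n) C suc k
    lemma₁ : ∀ a b → b ≡ (a + b) - a
    lemma₁ = solve-∀
    lemma₂ : ∀ x → 0ℤ - x ≡ -1ℤ * x
    lemma₂ = solve-∀

  -- For a non-residue a every x² - a is a unit, so summing (x² - a) ^ (p - 1)
  -- pins down a ^ n through its middle binomial coefficient.
  euler-nonresidue : ∀ a → ¬ + p ∣ a → ¬ IsSquareMod p a → a ^ n ≈ -1ℤ
  euler-nonresidue a p∤a ¬sq = begin
    a ^ n             ≡⟨ lemma₀ (a ^ n) ⟩
    (1ℤ + a ^ n) - 1ℤ ≈⟨ +-congʳ -1ℤ 1+a^n≈0 ⟩
    -1ℤ               ∎
    where
    lemma₀ : ∀ x → x ≡ (1ℤ + x) - 1ℤ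
    lemma₀ = solve-∀
    p∤-a : ¬ + p ∣ - a
    p∤-a d = p∤a (subst (+ p ∣_) (neg-involutive a) (∣m⇒∣-m d))
    unit : ∀ j → j ℕ.< n → ¬ + p ∣ 1ℤ * sq j - a
    unit j j<n d = ¬sq (fromℕ< j<p , subst (+ p ∣_)
      (cong (_- a) (trans (*-identityˡ (sq j)) (cong (λ z → (+ z) ^ 2) (sym (toℕ-fromℕ< j<p))))) d)
      where
      j<p : suc j ℕ.< p
      j<p = s<s (ℕ.<-≤-trans j<n (ℕ.m≤m+n n n))
    c = + ((n ℕ.+ n) C n)
    n≈ : + n ≈ + n * (1ℤ + a ^ n + 1ℤ)
    n≈ = begin
      + n
        ≡⟨ sum-one n ⟨
      Σ< n (λ _ → 1ℤ)
        ≈⟨ Σ<-cong-≈ n (λ j j<n → fermat-unit (1ℤ * sq j - a) (unit j j<n)) ⟨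
      Σ< n (λ j → (1ℤ * sq j - a) ^ (n ℕ.+ n))
        ≈⟨ powerSum-quadratic-top 1ℤ (- a) ⟩
      + n * ((- a) ^ (n ℕ.+ n) + c * (1ℤ ^ n * (- a) ^ n) + 1ℤ ^ (n ℕ.+ n))
        ≈⟨ *-congˡ (+ n) (+-cong (+-cong (fermat-unit (- a) p∤-a) middle) (≈-reflexive (^-zeroˡ (n ℕ.+ n)))) ⟩
      + n * (1ℤ + a ^ n + 1ℤ) ∎
      where
      middle : c * (1ℤ ^ n * (- a) ^ n) ≈ a ^ n
      middle = begin
        c * (1ℤ ^ n * (- a) ^ n)       ≡⟨ cong (λ z → c * (z * (- a) ^ n)) (^-zeroˡ n) ⟩
        c * (1ℤ * (- a) ^ n)           ≡⟨ cong (c *_) (*-identityˡ ((- a) ^ n)) ⟩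
        c * (- a) ^ n                  ≈⟨ *-congʳ ((- a) ^ n) ([p-1]Ck≈±1 n (s<s (ℕ.m≤m+n n n))) ⟩
        -1ℤ ^ n * (- a) ^ n            ≡⟨ ^-distribʳ-* -1ℤ (- a) n ⟨
        (-1ℤ * - a) ^ n                ≡⟨ cong (_^ n) (trans (-1*i≡-i (- a)) (neg-involutive a)) ⟩
        a ^ n                          ∎
    1+a^n≈0 : 1ℤ + a ^ n ≈ 0ℤ
    1+a^n≈0 = *-cancelˡ-≈0 (+ n) p∤n (begin
      + n * (1ℤ + a ^ n)               ≡⟨ lemma (+ n) (a ^ n) ⟩
      + n * (1ℤ + a ^ n + 1ℤ) - + n    ≈⟨ +-congʳ (- (+ n)) n≈ ⟨
      + n - + n                        ≡⟨ +-inverseʳ (+ n) ⟩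
      0ℤ                               ∎)
      where
      lemma : ∀ n x → n * (1ℤ + x) ≡ n * (1ℤ + x + 1ℤ) - n
      lemma = solve-∀

  euler : ∀ a → legendre a p ≈ a ^ n
  euler a with legendre-cases a
  ... | inj₁ (p∣a , eq) rewrite eq =
    ≈-sym (≈-trans (^-cong n (∣⇒≈0 p∣a)) (≈-reflexive (0^1+n n′)))
  ... | inj₂ (inj₁ (p∤a , (x , x²≈a) , eq)) rewrite eq = ≈-sym (begin
    a ^ n                   ≈⟨ ^-cong n x²≈a′ ⟨
    ((+ toℕ x) ^ 2) ^ n     ≡⟨ ^-*-assoc (+ toℕ x) 2 n ⟩
    (+ toℕ x) ^ (2 ℕ.* n)   ≡⟨ cong (λ z → (+ toℕ x) ^ (n ℕ.+ z)) (ℕ.+-identityʳ n) ⟩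
    (+ toℕ x) ^ (n ℕ.+ n)   ≈⟨ fermat-unit (+ toℕ x) p∤x ⟩
    1ℤ                      ∎)
    where
    x²≈a′ : (+ toℕ x) ^ 2 ≈ a
    x²≈a′ = ∣⇒≈ x²≈a
    p∤x : ¬ + p ∣ + toℕ x
    p∤x d = p∤a (≈0⇒∣ (begin
      a               ≈⟨ x²≈a′ ⟨
      (+ toℕ x) ^ 2   ≈⟨ ∣⇒≈0 (∣m⇒∣m*n ((+ toℕ x) ^ 1) d) ⟩
      0ℤ              ∎))
  ... | inj₂ (inj₂ (p∤a , ¬sq , eq)) rewrite eq = ≈-sym (euler-nonresidue a p∤a ¬sq)

  -- Row and column sums of Legendre symbols.

  legendre-sum : ∀ u w → Σ< n (λ j → legendre (u * sq j + w) p) ≈ + n * (w ^ n + u ^ n)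
  legendre-sum u w = begin
    Σ< n (λ j → legendre (u * sq j + w) p)
      ≈⟨ Σ<-cong-≈ n (λ j _ → euler (u * sq j + w)) ⟩
    Σ< n (λ j → (u * sq j + w) ^ n)
      ≡⟨ Σ<-cong n (λ j → cong ((u * sq j + w) ^_) (ℕ.+-identityʳ n)) ⟨
    Σ< n (λ j → (u * sq j + w) ^ (n ℕ.+ 0))
      ≈⟨ powerSum-quadratic u w 0 z<s ⟩
    + n * (w ^ (n ℕ.+ 0) + + ((n ℕ.+ 0) C n) * (u ^ n * 1ℤ))
      ≡⟨ cong (λ z → + n * (w ^ z + + (z C n) * (u ^ n * 1ℤ))) (ℕ.+-identityʳ n) ⟩
    + n * (w ^ n + + (n C n) * (u ^ n * 1ℤ))
      ≡⟨ cong (λ z → + n * (w ^ n + + z * (u ^ n * 1ℤ))) (nCn≡1 n) ⟩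
    + n * (w ^ n + 1ℤ * (u ^ n * 1ℤ))
      ≡⟨ cong (λ z → + n * (w ^ n + z)) (trans (*-identityˡ (u ^ n * 1ℤ)) (*-identityʳ (u ^ n))) ⟩
    + n * (w ^ n + u ^ n) ∎

  -- Here u = 1 and w = dk², and (k²)^n ≡ 1 leaves w^n ≡ χ(d). Along a row u = d and w = j², with
  -- the same result.
  entry-columnSum≈ : ∀ d k → k ℕ.< n → Σ< n (λ j → entry d p (suc j) (suc k)) ≈ + n * (legendre d p + 1ℤ)
  entry-columnSum≈ d k k<n = begin
    Σ< n (λ j → legendre (sq j + d * sq k) p)
      ≡⟨ Σ<-cong n (λ j → cong (λ z → legendre (z + d * sq k) p) (*-identityˡ (sq j))) ⟨
    Σ< n (λ j → legendre (1ℤ * sq j + d * sq k) p)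
      ≈⟨ legendre-sum 1ℤ (d * sq k) ⟩
    + n * ((d * sq k) ^ n + 1ℤ ^ n)
      ≡⟨ cong₂ (λ x y → + n * (x + y)) (^-distribʳ-* d (sq k) n) (^-zeroˡ n) ⟩
    + n * (d ^ n * sq k ^ n + 1ℤ)
      ≈⟨ *-congˡ (+ n) (+-congʳ 1ℤ (*-cong (≈-sym (euler d)) (sq^n≈1 k k<n))) ⟩
    + n * (legendre d p * 1ℤ + 1ℤ)
      ≡⟨ cong (λ z → + n * (z + 1ℤ)) (*-identityʳ (legendre d p)) ⟩
    + n * (legendre d p + 1ℤ) ∎

  entry-rowSum≈ : ∀ d j → j ℕ.< n → Σ< n (λ k → entry d p (suc j) (suc k)) ≈ + n * (legendre d p + 1ℤ)
  entry-rowSum≈ d j j<n = begin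
    Σ< n (λ k → legendre (sq j + d * sq k) p)
      ≡⟨ Σ<-cong n (λ k → cong (λ z → legendre z p) (+-comm (sq j) (d * sq k))) ⟩
    Σ< n (λ k → legendre (d * sq k + sq j) p)
      ≈⟨ legendre-sum d (sq j) ⟩
    + n * (sq j ^ n + d ^ n)
      ≡⟨ cong (+ n *_) (+-comm (sq j ^ n) (d ^ n)) ⟩
    + n * (d ^ n + sq j ^ n)
      ≈⟨ *-congˡ (+ n) (+-cong (≈-sym (euler d)) (sq^n≈1 j j<n)) ⟩
    + n * (legendre d p + 1ℤ) ∎

  -- The sum is at most n in absolute value and 1 ≤ n, so the two sides differ by at most 2n < p.
  legendre-sum-exact : ∀ {c} (f : ℕ → ℤ) → ∣ c ∣ ℕ.≤ 1 →
    Σ< n (λ j → legendre (f j) p) ≈ c → Σ< n (λ j → legendre (f j) p) ≡ c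
  legendre-sum-exact {c} f c≤1 = ≈⇒≡ (s≤s (ℕ.≤-trans (∣i-j∣≤∣i∣+∣j∣ (Σ< n (λ j → legendre (f j) p)) c)
    (ℕ.+-mono-≤ (∣Σ<∣≤ n (λ j → legendre (f j) p) (λ i → ∣legendre∣≤1 (f i))) (ℕ.≤-trans c≤1 (s≤s z≤n)))))

  n*2≈-1 : + n * (1ℤ + 1ℤ) ≈ -1ℤ
  n*2≈-1 = ∣⇒≈ (subst (+ p ∣_) (lemma (+ n)) ∣-refl)
    where
    lemma : ∀ n → 1ℤ + (n + n) ≡ n * (1ℤ + 1ℤ) - -1ℤ
    lemma = solve-∀

  n*0≈0 : + n * (-1ℤ + 1ℤ) ≈ 0ℤ
  n*0≈0 = ≈-reflexive (*-zeroʳ (+ n))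

  entryMatrix : ℤ → Matrix n
  entryMatrix d j k = entry d p (suc (toℕ j)) (suc (toℕ k))

  -- The determinant identities and the vanishing of `Tₘ` modulo p.

  module _ (d : ℤ) where

    columnSum≡ : ∀ {c e} → legendre d p ≡ e → + n * (e + 1ℤ) ≈ c → ∣ c ∣ ℕ.≤ 1 →
      ∀ k → ∑[ j < n ] (entryMatrix d j k) ≡ c
    columnSum≡ eq n[e+1]≈c c≤1 k = legendre-sum-exact (λ j → form d (suc j) (suc (toℕ k))) c≤1
      (≈-trans (entry-columnSum≈ d (toℕ k) (toℕ<n k)) (≈-trans (≈-reflexive (cong (λ z → + n * (z + 1ℤ)) eq)) n[e+1]≈c))

    rowSum≡ : ∀ {c e} → legendre d p ≡ e → + n * (e + 1ℤ) ≈ c → ∣ c ∣ ℕ.≤ 1 →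
      ∀ j → ∑[ k < n ] (entryMatrix d j k) ≡ c
    rowSum≡ eq n[e+1]≈c c≤1 j = legendre-sum-exact (λ k → form d (suc (toℕ j)) (suc k)) c≤1
      (≈-trans (entry-rowSum≈ d (toℕ j) (toℕ<n j)) (≈-trans (≈-reflexive (cong (λ z → + n * (z + 1ℤ)) eq)) n[e+1]≈c))

    onesRowEntry : ℕ → ℕ → ℤ
    onesRowEntry j k = if j ℕ.≡ᵇ 1 then 1ℤ else entry d p j k

    S̄≡onesRow : detRange 1 n onesRowEntry ≡ det (onesRow (entryMatrix d))
    S̄≡onesRow = det-cong {A = λ j k → onesRowEntry (suc (toℕ j)) (suc (toℕ k))} {B = onesRow (entryMatrix d)}
      λ { zero k → refl ; (suc j) k → refl }

    S̄≡-S : legendre d p ≡ 1ℤ → S̄ d p ≡ - S d p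
    -- `half p` equals `n` only propositionally and also fixes the size of the matrix, so the whole
    -- identity is transported along `h`.
    S̄≡-S eq = subst (λ h → detRange 1 h onesRowEntry ≡ - detRange 1 h (entry d p)) (sym half≡n)
      (trans S̄≡onesRow (det-onesRow-columnSums≡-1 (entryMatrix d) (columnSum≡ eq n*2≈-1 ℕ.≤-refl)))

    legendre≈⇒≡ : ∀ a {c} → ∣ c ∣ ℕ.≤ 1 → a ^ n ≈ c → legendre a p ≡ c
    legendre≈⇒≡ a {c} c≤1 d≈ = ≈⇒≡
      (ℕ.≤-<-trans (∣i-j∣≤∣i∣+∣j∣ (legendre a p) c)
        (ℕ.≤-<-trans (ℕ.+-mono-≤ (∣legendre∣≤1 a) c≤1) (s<s (s<s (ℕ.≤-trans z<s (ℕ.m≤n+m n n′))))))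
      (≈-trans (euler a) d≈)

    -- Multiplicativity of the symbol is taken from Euler's criterion: (dk²)^n = d^n (k²)^n, with
    -- (k²)^n ≡ 1.
    bordered : legendre d p ≡ -1ℤ → IsBordered (entryMatrix d) (λ j k → entry d p (toℕ j) (toℕ k))
    bordered eq = record
      { top = λ k → legendre≈⇒≡ (form d 0 (suc (toℕ k))) ℕ.≤-refl (begin
          (0ℤ + d * sq (toℕ k)) ^ n    ≡⟨ cong (_^ n) (+-identityˡ (d * sq (toℕ k))) ⟩
          (d * sq (toℕ k)) ^ n         ≡⟨ ^-distribʳ-* d (sq (toℕ k)) n ⟩
          d ^ n * sq (toℕ k) ^ n       ≈⟨ *-cong (≈-sym (euler d)) (sq^n≈1 (toℕ k) (toℕ<n k)) ⟩
          legendre d p * 1ℤ            ≡⟨ cong (_* 1ℤ) eq ⟩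
          -1ℤ                          ∎)
      ; left = λ j → legendre≈⇒≡ (form d (suc (toℕ j)) 0) ℕ.≤-refl (begin
          (sq (toℕ j) + d * 0ℤ) ^ n    ≡⟨ cong (_^ n) (trans (cong (_+_ (sq (toℕ j))) (*-zeroʳ d)) (+-identityʳ (sq (toℕ j)))) ⟩
          sq (toℕ j) ^ n               ≈⟨ sq^n≈1 (toℕ j) (toℕ<n j) ⟩
          1ℤ                           ∎)
      ; inner = λ _ _ → refl
      }

    T≡nS̄ : legendre d p ≡ -1ℤ → detRange 0 n (entry d p) ≡ + n * detRange 1 n onesRowEntry
    T≡nS̄ eq = trans (det-bordered-columnSums≡0 (bordered eq) (columnSum≡ eq n*0≈0 z≤n))
      (cong (+ n *_) (sym S̄≡onesRow))

    S̄≡nD : legendre d p ≡ -1ℤ → detRange 1 n onesRowEntry ≡ + n * detRange 2 n (entry d p)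
    S̄≡nD eq = trans S̄≡onesRow (det-onesRow-rowSums≡0 (entryMatrix d) (rowSum≡ eq n*0≈0 z≤n))

    -- v₀ is chosen so that in column k the sum v₀ row₀ + row₁ + ⋯ + rowₙ is congruent to
    -- n C(m,n) wᵐ⁻ⁿ (1 - (d k) ^ (p - 1)) with w = d k², which p divides as d k divides w.
    p∣det-form^ : ∀ t → suc t ℕ.< n → + p ∣ detRange 0 n (λ j k → form d j k ^ (n ℕ.+ suc t))
    p∣det-form^ t′ t<n = subst (+ p ∣_)
      (trans (det-rowCombination A B (suc zero) v B-other (λ _ → refl)) (*-identityˡ (det A)))
      (∣-det (+ p) B (suc zero) λ k → ≈0⇒∣ (row≈0 (toℕ k)))
      where
      t = suc t′
      m = n ℕ.+ t
      c = + (m C n)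
      v₀ = - (+ n * (1ℤ + c * d ^ n))
      A B : Matrix (suc n)
      A j k = form d (toℕ j) (toℕ k) ^ m
      v : Fin (suc n) → ℤ
      v zero    = v₀
      v (suc _) = 1ℤ
      B zero          k = A zero k
      B (suc zero)    k = ∑[ i < suc n ] (v i * A i k)
      B (suc (suc i)) k = A (suc (suc i)) k
      B-other : ∀ i k → B (punchIn (suc zero) i) k ≡ A (punchIn (suc zero) i) k
      B-other zero    k = refl
      B-other (suc i) k = refl
      row≈0 : ∀ k → v₀ * form d 0 k ^ m + Σ< n (λ j → 1ℤ * form d (suc j) k ^ m) ≈ 0ℤ
      row≈0 k = begin
        v₀ * form d 0 k ^ m + Σ< n (λ j → 1ℤ * form d (suc j) k ^ m)
          ≡⟨ cong₂ (λ x y → v₀ * x ^ m + y) (+-identityˡ w) (Σ<-cong n λ j →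
               trans (*-identityˡ (form d (suc j) k ^ m)) (cong (λ z → (z + w) ^ m) (sym (*-identityˡ (sq j))))) ⟩
        v₀ * w ^ m + Σ< n (λ j → (1ℤ * sq j + w) ^ m)
          ≈⟨ +-congˡ (v₀ * w ^ m) (powerSum-quadratic 1ℤ w t t<n) ⟩
        v₀ * w ^ m + + n * (w ^ m + c * (1ℤ ^ n * w ^ t))
          ≡⟨ cong (λ z → v₀ * w ^ m + + n * (w ^ m + c * (z * w ^ t))) (^-zeroˡ n) ⟩
        v₀ * w ^ m + + n * (w ^ m + c * (1ℤ * w ^ t))
          ≡⟨ cong (λ z → v₀ * z + + n * (z + c * (1ℤ * w ^ t))) (^-distribˡ-+-* w n t) ⟩
        v₀ * (w ^ n * w ^ t) + + n * (w ^ n * w ^ t + c * (1ℤ * w ^ t))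
          ≡⟨ lemma₁ (+ n) c (d ^ n) (w ^ n) (d * (+ k * (+ k * 1ℤ))) (w ^ t′) ⟩
        + n * c * w ^ t′ * (w - w * (d ^ n * w ^ n))
          ≡⟨ cong (λ z → + n * c * w ^ t′ * (w - w * z)) d^n*w^n ⟩
        + n * c * w ^ t′ * (w - w * y ^ (n ℕ.+ n))
          ≡⟨ cong (+ n * c * w ^ t′ *_) (lemma₂ d (+ k) (y ^ (n ℕ.+ n))) ⟩
        + n * c * w ^ t′ * (+ k * (y - y ^ p))
          ≈⟨ *-congˡ (+ n * c * w ^ t′) (*-congˡ (+ k) (∣⇒≈0 (≈⇒∣ (≈-sym (fermat y))))) ⟩
        + n * c * w ^ t′ * (+ k * 0ℤ)
          ≡⟨ lemma₃ (+ n * c * w ^ t′) (+ k) ⟩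
        0ℤ ∎
        where
        w = d * (+ k) ^ 2
        y = d * + k
        lemma₁ : ∀ n c e f w x → - (n * (1ℤ + c * e)) * (f * (w * x)) + n * (f * (w * x) + c * (1ℤ * (w * x)))
          ≡ n * c * x * (w - w * (e * f))
        lemma₁ = solve-∀
        lemma₂ : ∀ d k z → d * (k * (k * 1ℤ)) - d * (k * (k * 1ℤ)) * z ≡ k * (d * k - d * k * z)
        lemma₂ = solve-∀
        lemma₃ : ∀ a k → a * (k * 0ℤ) ≡ 0ℤ
        lemma₃ = solve-∀
        lemma₄ : ∀ d k → d * (d * (k * (k * 1ℤ))) ≡ d * k * (d * k)
        lemma₄ = solve-∀
        d^n*w^n : d ^ n * w ^ n ≡ y ^ (n ℕ.+ n)
        d^n*w^n = trans (sym (^-distribʳ-* d w n)) (trans (cong (_^ n) (lemma₄ d (+ k)))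
          (trans (^-distribʳ-* y y n) (sym (^-distribˡ-+-* y n n))))

    2/[p-1]*T≡S̄ : legendre d p ≡ -1ℤ → ((+ 2) ℚ./ (n ℕ.+ n)) ℚ.* fromℤ (T d p) ≡ fromℤ (S̄ d p)
    2/[p-1]*T≡S̄ eq = subst
      (λ h → ((+ 2) ℚ./ (n ℕ.+ n)) ℚ.* fromℤ (detRange 0 h (entry d p)) ≡ fromℤ (detRange 1 h onesRowEntry))
      (sym half≡n)
      (/-*-fromℤ (+ 2) (n′ ℕ.+ n) (detRange 0 n (entry d p)) (detRange 1 n onesRowEntry)
        (trans (cong (+ 2 *_) (T≡nS̄ eq)) (lemma (+ n) (detRange 1 n onesRowEntry))))
      where
      lemma : ∀ n x → + 2 * (n * x) ≡ x * (n + n)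
      lemma = solve-∀

    [p-1]/2*D≡S̄ : legendre d p ≡ -1ℤ →
      (+ (n ℕ.+ n) ℚ./ 2) ℚ.* fromℤ (detRange 2 (half p) (entry d p)) ≡ fromℤ (S̄ d p)
    [p-1]/2*D≡S̄ eq = subst
      (λ h → (+ (n ℕ.+ n) ℚ./ 2) ℚ.* fromℤ (detRange 2 h (entry d p)) ≡ fromℤ (detRange 1 h onesRowEntry))
      (sym half≡n)
      (/-*-fromℤ (+ (n ℕ.+ n)) 1 (detRange 2 n (entry d p)) (detRange 1 n onesRowEntry)
        (trans (lemma (+ n) (detRange 2 n (entry d p))) (cong (_* + 2) (sym (S̄≡nD eq)))))
      where
      lemma : ∀ n x → (n + n) * x ≡ n * x * + 2
      lemma = solve-∀

    p∣Tₘ : ∀ m → half p ℕ.< m → m ℕ.< n ℕ.+ n → + p ∣ Tₘ m d p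
    p∣Tₘ m h<m m<2n = subst (λ h → + p ∣ detRange 0 h (λ j k → form d j k ^ m)) (sym half≡n)
      (subst (λ m → + p ∣ detRange 0 n (λ j k → form d j k ^ m)) n+1+t≡m (p∣det-form^ t 1+t<n))
      where
      n<m : n ℕ.< m
      n<m = subst (ℕ._< m) half≡n h<m
      -- The range n < m < 2n becomes m = n + (t + 1) with t + 1 < n.
      t = m ℕ.∸ suc n
      n+1+t≡m : n ℕ.+ suc t ≡ m
      n+1+t≡m = trans (ℕ.+-suc n t) (ℕ.m+[n∸m]≡n n<m)
      1+t<n : suc t ℕ.< n
      1+t<n = ℕ.+-cancelˡ-< n (suc t) n (subst (ℕ._< n ℕ.+ n) (sym n+1+t≡m) m<2n)

open import Data.Integer.Base using (ℤ; +_; -_; 1ℤ; -1ℤ)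
open import Data.Integer.Divisibility.Signed using (_∣_)
open import Data.Nat.Base using (ℕ; _∸_; _<_; _>_)
open import Data.Nat.Primality using (Prime)
open import Data.Product.Base using (_×_)
open import Data.Rational.Base using (_/_; _*_)
open import Relation.Binary.PropositionalEquality using (_≡_)

theorem1p1 : (p : ℕ) → Prime p → (p>3 : p > 3) → (d : ℤ) →
  let 2/[p-1] = ((+ 2) / (p ∸ 1)) {{ p>3⇒p∸1≢0 p>3 }}
      [p-1]/2 = (+ (p ∸ 1)) / 2
  in
    (legendre d p ≡ 1ℤ → S̄ d p ≡ - S d p)
    × (legendre d p ≡ -1ℤ →
         (fromℤ (S̄ d p) ≡ 2/[p-1] * fromℤ (T d p))
         × (2/[p-1] * fromℤ (T d p) ≡ [p-1]/2 * fromℤ (detRange 2 (half p) (entry d p))))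
    × ((m : ℕ) → half p < m → m < p ∸ 1 → + p ∣ Tₘ m d p)
theorem1p1 p p-prime p>3 d with prime>3⇒odd p-prime p>3
... | n′ , refl =
  S̄≡-S d , (λ eq → sym (2/[p-1]*T≡S̄ d eq) , trans (2/[p-1]*T≡S̄ d eq) (sym ([p-1]/2*D≡S̄ d eq))) , p∣Tₘ d
  where open OddPrime n′ p-prime
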